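{- For $0\le i\le k<n$ we have the identity $$\check\Phi(n,k+1,i)=\check\Phi(n,k,i)+\check\Phi(n,k+1,i+1).$$
   Context: A quasi-graded poset $(P,\rho,\bar\zeta)$ consists of a finite poset $P$, a function $\rho:P\to\mathbb N$ with $x<y\Rightarrow\rho(x)<\rho(y)$, and a function $\bar\zeta$ in the incidence algebra of $P$ with $\bar\zeta(x,x)=1$. Write $\rho(x,y)=\rho(y)-\rho(x)$. If $P$ has minimal element $\hat0$ and maximal element $\hat1$, $\hat0<\hat1$, its $\mathbf{ab}$-index is the polynomial in non-commuting variables $\mathbf a,\mathbf b$ $$\Psi(P)=\sum\bar\zeta(x_0,x_1)\cdots\bar\zeta(x_{k-1},x_k)\cdot(\mathbf a-\mathbf b)^{\rho(x_0,x_1)-1}\,\mathbf b\,(\mathbf a-\mathbf b)^{\rho(x_1,x_2)-1}\,\mathbf b\cdots\mathbf b\,(\mathbf a-\mathbf b)^{\rho(x_{k-1},x_k)-1},$$ summed over all chains $\hat0=x_0<x_1<\cdots<x_k=\hat1$. Semisuspension. For $n\ge1$ and a finite simplicial complex $\Delta$ (containing $\emptyset$) with $\dim\Delta<n$, $\mathrm{Semi}(\Delta,n)$ is obtained by embedding $\Delta$ in the boundary of an $n$-ball; its face poset $\mathcal F(\mathrm{Semi}(\Delta,n))$ is the following quasi-graded poset, independent of the embedding: the elements are the faces of $\Delta$ (with $\hat0=\emptyset$) and two further elements $*$ and $\hat1$; $\rho(F)=\dim F+1$, $\rho(*)=n$, $\rho(\hat1)=n+1$; faces are ordered by inclusion,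 every other element is $<\hat1$, and $F<*$ for every face $F$ with $\rho(F)<n$ (faces of dimension $n-1$ are incomparable to $*$); $$\bar\zeta(F,*)=1+(-1)^{n-\rho(F)}\,\widetilde\chi(\mathrm{link}_\Delta(F)),\qquad\widetilde\chi(\mathrm{link}_\Delta(F))=\sum_{H\in\Delta,\,H\supseteq F}(-1)^{\dim H-\dim F-1},$$ and $\bar\zeta=1$ on all other intervals. For $0\le i\le k$, $\Delta_{k,i}$ is the simplicial complex generated by $i+1$ of the facets of the $k$-dimensional simplex (so $\dim\Delta_{k,i}=k-1$, and $\Delta_{0,0}=\{\emptyset\}$). For $0\le i\le k\le n$ let $P_{n,k,i}=\mathcal F(\mathrm{Semi}(\Delta_{k,i},n))$. The $\mathbf{cd}$-indexes of the simplicial shelling components are $\check\Phi(n,k,0)=\Psi(P_{n,k,0})$ and $\check\Phi(n,k,i)=\Psi(P_{n,k,i})-\Psi(P_{n,k,i-1})$ for $1\le i\le k\le n$. -}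

module Defs where

open import Level using (0ℓ)
open import Data.Nat using (ℕ; zero; suc; _≤_; _<_; _∸_; z≤n; s≤s)
import Data.Nat.Properties as ℕ
open import Data.Integer as ℤ using (ℤ; 0ℤ; 1ℤ; -1ℤ)
open import Data.Fin using (Fin; zero; suc; toℕ)
import Data.Fin.Properties as Fin
open import Data.Fin.Subset
  using (Subset; Side; inside; outside; _⊆_; ∣_∣; ⊥; ∁; ⁅_⁆)
open import Data.Fin.Subset.Properties
  using (_⊆?_; ⊆-refl; ⊆-trans; ⊆-antisym; ⊥⊆; ∣⊥∣≡0; p⊆q⇒∣p∣≤∣q∣;
         ∣∁p∣≡n∸∣p∣; ∣⁅x⁆∣≡1; drop-∷-⊆)
import Data.Bool.Properties as Bool
open import Data.Vec using ([]; _∷_; here)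
import Data.Vec.Properties as Vec
open import Data.List using (List; []; _∷_; [_]; _++_; map; foldr; filter; cartesianProductWith)
import Data.List.Properties as List
open import Data.List.Membership.Propositional using (_∈_)
open import Data.List.Membership.Propositional.Properties using (∈-cartesianProductWith⁺)
import Data.List.Relation.Unary.Any as Any
open import Data.List.Relation.Unary.All as All using (All; []; _∷_)
import Data.List.Relation.Unary.AllPairs as AllPairs
open AllPairs using ([]; _∷_)
open import Data.List.Relation.Unary.Unique.Propositional using (Unique)
open import Data.List.Relation.Unary.Unique.Propositional.Properties using (cartesianProductWith⁺)
open import Data.Product using (∃; _×_; _,_)
open import Function using (_∘_)
open import Relation.Nullary using (Dec; yes; no; recompute; contradiction)
open import Relation.Nullary.Decidable using (_×-dec_; map′)
open import Relation.Unary using (Pred; Decidable)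
open import Relation.Binary using (Rel; DecidableEquality; IsDecPartialOrder)
import Relation.Binary.Construct.NonStrictToStrict as ToStrict
open import Relation.Binary.PropositionalEquality
  using (_≡_; _≢_; refl; sym; trans; cong; cong₂; subst; isEquivalence)

------------------------------------------------------------------------
-- Noncommutative polynomials ℤ⟨a,b⟩

data Letter : Set where
  a b : Letter

_≟ᴸ_ : DecidableEquality Letter
a ≟ᴸ a = yes refl
a ≟ᴸ b = no λ ()
b ≟ᴸ a = no λ ()
b ≟ᴸ b = yes refl

Word : Set
Word = List Letter

-- A polynomial is a formal sum of terms (coefficient , monomial). The same
-- monomial may occur several times, so polynomials are compared by _≈ᵖ_.
Poly : Set
Poly = List (ℤ × Word)

coeff : Poly → Word → ℤ
coeff []            w = 0ℤ
coeff ((c , v) ∷ p) w with List.≡-dec _≟ᴸ_ v w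
... | yes _ = c ℤ.+ coeff p w
... | no  _ = coeff p w

infix  4 _≈ᵖ_
infixl 6 _+ᵖ_ _-ᵖ_
infixl 7 _*ᵖ_
infixr 8 _^ᵖ_
infixr 7 _·ᵖ_

_≈ᵖ_ : Rel Poly 0ℓ
p ≈ᵖ q = ∀ w → coeff p w ≡ coeff q w

0ᵖ 1ᵖ 𝐚 𝐛 : Poly
0ᵖ = []
1ᵖ = [ 1ℤ , [] ]
𝐚  = [ 1ℤ , [ a ] ]
𝐛  = [ 1ℤ , [ b ] ]

_+ᵖ_ _-ᵖ_ _*ᵖ_ : Poly → Poly → Poly
_·ᵖ_ : ℤ → Poly → Poly
_^ᵖ_ : Poly → ℕ → Poly
p +ᵖ q = p ++ q
c ·ᵖ p = map (λ (d , w) → c ℤ.* d , w) p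
p -ᵖ q = p +ᵖ -1ℤ ·ᵖ q
p *ᵖ q = cartesianProductWith (λ (c , v) (d , w) → c ℤ.* d , v ++ w) p q
p ^ᵖ zero  = 1ᵖ
p ^ᵖ suc k = p *ᵖ p ^ᵖ k

sumᵖ : List Poly → Poly
sumᵖ = foldr _+ᵖ_ 0ᵖ

------------------------------------------------------------------------
-- Quasi-graded posets and the ab-index

-- ζ̄ x y is meaningful only for x ≤ y; its other values are never used.
record QuasiGradedPoset : Set₁ where
  infix 4 _≼_ _≺?_
  field
    Carrier           : Set
    _≼_               : Rel Carrier 0ℓ
    isDecPartialOrder : IsDecPartialOrder _≡_ _≼_
    elements          : List Carrier
    elements-complete : ∀ x → x ∈ elements
    elements-unique   : Unique elements

  open ToStrict _≡_ _≼_ public using () renaming (_<_ to _≺_)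

  field
    ρ      : Carrier → ℕ
    ρ-mono : ∀ {x y} → x ≺ y → ρ x < ρ y
    ζ̄      : Carrier → Carrier → ℤ
    ζ̄-diag : ∀ x → ζ̄ x x ≡ 1ℤ

  open IsDecPartialOrder isDecPartialOrder public using (_≟_; _≤?_)

  _≺?_ : ∀ x y → Dec (x ≺ y)
  _≺?_ = ToStrict.<-decidable _≡_ _≼_ _≟_ _≤?_

  ρ[_,_] : Carrier → Carrier → ℕ
  ρ[ x , y ] = ρ y ∸ ρ x

record BoundedQuasiGradedPoset : Set₁ where
  field
    quasiGradedPoset : QuasiGradedPoset
  open QuasiGradedPoset quasiGradedPoset public
  field
    0̂ 1̂     : Carrier
    minimum : ∀ x → 0̂ ≼ x
    maximum : ∀ x → x ≼ 1̂
    0̂≺1̂     : 0̂ ≺ 1̂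

module _ (P : QuasiGradedPoset) where
  open QuasiGradedPoset P

  infixr 5 _∷ᶜ_

  -- Chains x = x₀ ≺ x₁ ≺ … ≺ x_k = y with k ≥ 1. The irrelevant arguments
  -- make a chain depend only on its elements.
  data Chain : Carrier → Carrier → Set where
    [_]ᶜ : ∀ {x y} → .(x ≺ y) → Chain x y
    _∷ᶜ_ : ∀ {x y z} → .(x ≺ y) → Chain y z → Chain x z

  weight : ∀ {x z} → Chain x z → Poly
  weight ([_]ᶜ {x} {z} _)     = ζ̄ x z ·ᵖ (𝐚 -ᵖ 𝐛) ^ᵖ (ρ[ x , z ] ∸ 1)
  weight (_∷ᶜ_ {x} {y} _ c) =
    ζ̄ x y ·ᵖ ((𝐚 -ᵖ 𝐛) ^ᵖ (ρ[ x , y ] ∸ 1) *ᵖ 𝐛 *ᵖ weight c)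

  -- All chains from x to z with at most the given number of steps, each
  -- listed once.
  chains : ℕ → ∀ x z → List (Chain x z)
  chains-via : ℕ → ∀ x z → List Carrier → List (Chain x z)
  direct : ∀ x z → List (Chain x z)

  chains zero    x z = []
  chains (suc k) x z = direct x z ++ chains-via k x z elements

  direct x z with x ≺? z
  ... | yes x≺z = [ [ x≺z ]ᶜ ]
  ... | no  _   = []

  chains-via k x z []       = []
  chains-via k x z (y ∷ ys) with x ≺? y
  ... | yes x≺y = map (x≺y ∷ᶜ_) (chains k y z) ++ chains-via k x z ys
  ... | no  _   = chains-via k x z ys

-- As ρ is strictly increasing, no chain from 0̂ to 1̂ has more than
-- ρ[ 0̂ , 1̂ ] steps, so the sum ranges over all of them.
Ψ : BoundedQuasiGradedPoset → Poly
Ψ P = sumᵖ (map (weight quasiGradedPoset) (chains quasiGradedPoset ρ[ 0̂ , 1̂ ] 0̂ 1̂))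
  where open BoundedQuasiGradedPoset P

------------------------------------------------------------------------
-- Finite simplicial complexes

-- Not every element of Fin m has to be a vertex.
record SimplicialComplex (m : ℕ) : Set₁ where
  field
    IsFace      : Pred (Subset m) 0ℓ
    isFace?     : Decidable IsFace
    ∅-face      : IsFace ⊥
    down-closed : ∀ {F G} → F ⊆ G → IsFace G → IsFace F

dim : ∀ {m} → Subset m → ℤ
dim F = ∣ F ∣ ℤ.⊖ 1

sides : List Side
sides = outside ∷ inside ∷ []

subsets : ∀ m → List (Subset m)
subsets zero    = [ [] ]
subsets (suc m) = cartesianProductWith _∷_ sides (subsets m)

-1^_ : ℤ → ℤ
-1^ z = -1ℤ ℤ.^ ℤ.∣ z ∣

-- The reduced Euler characteristic of the link of F; H below stands for the
-- face H ∖ F of the link.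
χ̃-link : ∀ {m} → SimplicialComplex m → Subset m → ℤ
χ̃-link {m} Δ F =
  foldr ℤ._+_ 0ℤ
    (map (λ H → -1^ (dim H ℤ.- dim F ℤ.- 1ℤ))
         (filter (λ H → isFace? H ×-dec (F ⊆? H)) (subsets m)))
  where open SimplicialComplex Δ

subsets-complete : ∀ {m} (F : Subset m) → F ∈ subsets m
subsets-complete []            = Any.here refl
subsets-complete (outside ∷ F) =
  ∈-cartesianProductWith⁺ _∷_ {xs = sides} (Any.here refl) (subsets-complete F)
subsets-complete (inside ∷ F)  =
  ∈-cartesianProductWith⁺ _∷_ {xs = sides} (Any.there (Any.here refl)) (subsets-complete F)

subsets-unique : ∀ m → Unique (subsets m)
subsets-unique zero    = [] ∷ []
subsets-unique (suc m) =
  cartesianProductWith⁺ _∷_ Vec.∷-injective (((λ ()) ∷ []) ∷ [] ∷ []) (subsets-unique m)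

⊆∧≢⇒∣∣< : ∀ {m} {F G : Subset m} → F ⊆ G → F ≢ G → ∣ F ∣ < ∣ G ∣
⊆∧≢⇒∣∣< {F = []}          {[]}          F⊆G F≢G = contradiction refl F≢G
⊆∧≢⇒∣∣< {F = outside ∷ F} {outside ∷ G} F⊆G F≢G =
  ⊆∧≢⇒∣∣< (drop-∷-⊆ F⊆G) (F≢G ∘ cong (outside ∷_))
⊆∧≢⇒∣∣< {F = outside ∷ F} {inside ∷ G}  F⊆G F≢G = s≤s (p⊆q⇒∣p∣≤∣q∣ (drop-∷-⊆ F⊆G))
⊆∧≢⇒∣∣< {F = inside ∷ F}  {outside ∷ G} F⊆G F≢G = contradiction (F⊆G here) λ ()
⊆∧≢⇒∣∣< {F = inside ∷ F}  {inside ∷ G}  F⊆G F≢G =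
  s≤s (⊆∧≢⇒∣∣< (drop-∷-⊆ F⊆G) (F≢G ∘ cong (inside ∷_)))

------------------------------------------------------------------------
-- The face poset of the semisuspension

-- dim<n says dim Δ < n, since dim F = ∣ F ∣ - 1.
module Semi {m} (Δ : SimplicialComplex m) (n : ℕ) (1≤n : 1 ≤ n)
            (dim<n : ∀ F → SimplicialComplex.IsFace Δ F → ∣ F ∣ ≤ n) where
  open SimplicialComplex Δ

  data Element : Set where
    face : (F : Subset m) → .(IsFace F) → Element
    ∗    : Element
    top  : Element

  infix 4 _⊑_ _⊑?_ _≟_

  data _⊑_ : Rel Element 0ℓ where
    face⊑face : ∀ {F G} .{p : IsFace F} .{q : IsFace G} → F ⊆ G → face F p ⊑ face G q
    face⊑∗    : ∀ {F} .{p : IsFace F} → ∣ F ∣ < n → face F p ⊑ ∗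
    ∗⊑∗       : ∗ ⊑ ∗
    ⊑top      : ∀ {x} → x ⊑ top

  rank : Element → ℕ
  rank (face F _) = ∣ F ∣
  rank ∗          = n
  rank top        = suc n

  zeta : Element → Element → ℤ
  zeta (face F _) ∗ = 1ℤ ℤ.+ (-1ℤ ℤ.^ (n ∸ ∣ F ∣)) ℤ.* χ̃-link Δ F
  zeta _          _ = 1ℤ

  _⊑?_ : ∀ x y → Dec (x ⊑ y)
  face F _ ⊑? face G _ = map′ face⊑face (λ { (face⊑face F⊆G) → F⊆G }) (F ⊆? G)
  face F _ ⊑? ∗        = map′ face⊑∗ (λ { (face⊑∗ F<n) → F<n }) (∣ F ∣ ℕ.<? n)
  ∗        ⊑? face G _ = no λ ()
  ∗        ⊑? ∗        = yes ∗⊑∗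
  top      ⊑? face G _ = no λ ()
  top      ⊑? ∗        = no λ ()
  _        ⊑? top      = yes ⊑top

  face-cong : ∀ {F G} .{p : IsFace F} .{q : IsFace G} → F ≡ G → face F p ≡ face G q
  face-cong refl = refl

  _≟_ : DecidableEquality Element
  face F _ ≟ face G _ = map′ face-cong (λ { refl → refl }) (Vec.≡-dec Bool._≟_ F G)
  face F _ ≟ ∗        = no λ ()
  face F _ ≟ top      = no λ ()
  ∗        ≟ face G _ = no λ ()
  ∗        ≟ ∗        = yes refl
  ∗        ≟ top      = no λ ()
  top      ≟ face G _ = no λ ()
  top      ≟ ∗        = no λ ()
  top      ≟ top      = yes refl

  ⊑-reflexive : ∀ {x y} → x ≡ y → x ⊑ y
  ⊑-reflexive {face F _} refl = face⊑face ⊆-refl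
  ⊑-reflexive {∗}        refl = ∗⊑∗
  ⊑-reflexive {top}      refl = ⊑top

  ⊑-trans : ∀ {x y z} → x ⊑ y → y ⊑ z → x ⊑ z
  ⊑-trans (face⊑face F⊆G) (face⊑face G⊆H) = face⊑face (⊆-trans F⊆G G⊆H)
  ⊑-trans (face⊑face F⊆G) (face⊑∗ G<n)    = face⊑∗ (ℕ.≤-<-trans (p⊆q⇒∣p∣≤∣q∣ F⊆G) G<n)
  ⊑-trans (face⊑∗ F<n)    ∗⊑∗             = face⊑∗ F<n
  ⊑-trans ∗⊑∗             y⊑z             = y⊑z
  ⊑-trans _               ⊑top            = ⊑top

  ⊑-antisym : ∀ {x y} → x ⊑ y → y ⊑ x → x ≡ y
  ⊑-antisym (face⊑face F⊆G) (face⊑face G⊆F) = face-cong (⊆-antisym F⊆G G⊆F)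
  ⊑-antisym ∗⊑∗             _               = refl
  ⊑-antisym ⊑top            ⊑top            = refl

  faces : List (Subset m) → List Element
  faces []       = []
  faces (F ∷ Fs) with isFace? F
  ... | yes p = face F p ∷ faces Fs
  ... | no  _ = faces Fs

  face∈faces : ∀ {F} .(p : IsFace F) {Fs} → F ∈ Fs → face F p ∈ faces Fs
  face∈faces {F} p (Any.here refl) with isFace? F
  ... | yes _ = Any.here refl
  ... | no ¬p = contradiction (recompute (isFace? F) p) ¬p
  face∈faces p {G ∷ _} (Any.there F∈Fs) with isFace? G
  ... | yes _ = Any.there (face∈faces p F∈Fs)
  ... | no  _ = face∈faces p F∈Fs

  faces-all : ∀ {Q : Pred Element 0ℓ} {Fs} →
              All (λ F → ∀ (p : IsFace F) → Q (face F p)) Fs → All Q (faces Fs)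
  faces-all {Fs = []}     []       = []
  faces-all {Fs = F ∷ _} (q ∷ qs) with isFace? F
  ... | yes p = q p ∷ faces-all qs
  ... | no  _ = faces-all qs

  faces-unique : ∀ {Fs} → Unique Fs → Unique (faces Fs)
  faces-unique {[]}    []       = []
  faces-unique {F ∷ _} (F∉ ∷ u) with isFace? F
  ... | yes p = faces-all (All.map (λ F≢G _ → λ { refl → F≢G refl }) F∉) ∷ faces-unique u
  ... | no  _ = faces-unique u

  complete : ∀ x → x ∈ ∗ ∷ top ∷ faces (subsets m)
  complete (face F p) = Any.there (Any.there (face∈faces p (subsets-complete F)))
  complete ∗          = Any.here refl
  complete top        = Any.there (Any.here refl)

  unique : Unique (∗ ∷ top ∷ faces (subsets m))
  unique =
    ((λ ()) ∷ faces-all {Fs = subsets m} (All.universal (λ _ _ ()) _)) ∷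
    faces-all {Fs = subsets m} (All.universal (λ _ _ ()) _) ∷
    faces-unique (subsets-unique m)

  rank-mono : ∀ {x y} → x ⊑ y × x ≢ y → rank x < rank y
  rank-mono (face⊑face F⊆G , F≢G) = ⊆∧≢⇒∣∣< F⊆G (F≢G ∘ face-cong)
  rank-mono (face⊑∗ F<n    , _)   = F<n
  rank-mono (∗⊑∗           , ∗≢∗) = contradiction refl ∗≢∗
  rank-mono {face F p} (⊑top , _) =
    s≤s (recompute (∣ F ∣ ℕ.≤? n) (dim<n F p))
  rank-mono {∗}        (⊑top , _) = ℕ.≤-refl
  rank-mono {top}      (⊑top , t) = contradiction refl t

  zeta-diag : ∀ x → zeta x x ≡ 1ℤ
  zeta-diag (face _ _) = refl
  zeta-diag ∗          = refl
  zeta-diag top        = refl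

  ∅-min : ∀ x → face ⊥ ∅-face ⊑ x
  ∅-min (face _ _) = face⊑face ⊥⊆
  ∅-min ∗          = face⊑∗ (subst (_< n) (sym (∣⊥∣≡0 m)) 1≤n)
  ∅-min top        = ⊑top

  facePoset : BoundedQuasiGradedPoset
  facePoset = record
    { quasiGradedPoset = record
      { Carrier           = Element
      ; _≼_               = _⊑_
      ; isDecPartialOrder = record
        { isPartialOrder = record
          { isPreorder = record
            { isEquivalence = isEquivalence
            ; reflexive     = ⊑-reflexive
            ; trans         = ⊑-trans
            }
          ; antisym = ⊑-antisym
          }
        ; _≟_  = _≟_
        ; _≤?_ = _⊑?_
        }
      ; elements          = ∗ ∷ top ∷ faces (subsets m)
      ; elements-complete = complete
      ; elements-unique   = unique
      ; ρ                 = rank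
      ; ρ-mono            = rank-mono
      ; ζ̄                 = zeta
      ; ζ̄-diag            = zeta-diag
      }
    ; 0̂       = face ⊥ ∅-face
    ; 1̂       = top
    ; minimum = ∅-min
    ; maximum = λ _ → ⊑top
    ; 0̂≺1̂     = ⊑top , λ ()
    }

------------------------------------------------------------------------
-- Simplicial shelling components

-- The facet of the k-simplex on the vertices 0, …, k that omits the vertex j.
facet : ∀ {k} → Fin (suc k) → Subset (suc k)
facet j = ∁ ⁅ j ⁆

-- For i ≤ k, the i + 1 generating facets are those omitting 0, …, i. All
-- choices of i + 1 facets give isomorphic complexes.
Δ[_,_] : (k i : ℕ) → SimplicialComplex (suc k)
Δ[ k , i ] = record
  { IsFace      = λ F → ∃ λ j → toℕ j ≤ i × F ⊆ facet j
  ; isFace?     = λ F → Fin.any? λ j → (toℕ j ℕ.≤? i) ×-dec (F ⊆? facet j)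
  ; ∅-face      = zero , z≤n , ⊥⊆
  ; down-closed = λ F⊆G (j , j≤i , G⊆) → j , j≤i , ⊆-trans F⊆G G⊆
  }

Δ-dim : ∀ k i {n} → k ≤ n → ∀ F → SimplicialComplex.IsFace Δ[ k , i ] F → ∣ F ∣ ≤ n
Δ-dim k i k≤n F (j , _ , F⊆) = ℕ.≤-trans (p⊆q⇒∣p∣≤∣q∣ F⊆) (subst (_≤ _) (sym ∣facet∣≡k) k≤n)
  where
  ∣facet∣≡k : ∣ facet j ∣ ≡ k
  ∣facet∣≡k = trans (∣∁p∣≡n∸∣p∣ ⁅ j ⁆) (cong (suc k ∸_) (∣⁅x⁆∣≡1 j))

P : (n k i : ℕ) → 1 ≤ n → i ≤ k → k ≤ n → BoundedQuasiGradedPoset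
P n k i 1≤n _ k≤n = Semi.facePoset Δ[ k , i ] n 1≤n (Δ-dim k i k≤n)

Φ̌ : (n k i : ℕ) → 1 ≤ n → i ≤ k → k ≤ n → Poly
Φ̌ n k zero    1≤n i≤k k≤n = Ψ (P n k zero 1≤n i≤k k≤n)
Φ̌ n k (suc i) 1≤n i<k k≤n =
  Ψ (P n k (suc i) 1≤n i<k k≤n) -ᵖ Ψ (P n k i 1≤n (ℕ.<⇒≤ i<k) k≤n)

{-# OPTIONS --safe #-}

-- The chains below the last face H they pass through are counted by the Boolean
-- algebra of subsets of H, and H then continues to the top either directly or
-- through ∗. Hence Ψ of a semisuspension is a sum over the faces H of a term that
-- depends only on n and ∣ H ∣, affinely on ζ̄(H,∗). With X = {0,…,i}, the faces of
-- Δ[ k , i ] are the subsets of {0,…,k} not containing X, and for them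
-- ζ̄(H,∗) = 1 + (-1)ⁿ⁺ᵏ⁺¹ [∁X ⊆ H]. Sums over supersets of a fixed set are binomial
-- sums, which reduces the identity to Pascal's rule.

module Submission where

open import Defs
open import Data.Bool using (if_then_else_)
open import Data.Nat as ℕ using (ℕ; zero; suc; _≤_; _<_; _∸_; z≤n; s≤s)
import Data.Nat.Properties as ℕ
open import Data.Nat.Properties using (<⇒≤; m≤n⇒m≤1+n; m<n⇒0<n)
open import Data.Integer as ℤ using (ℤ; 0ℤ; 1ℤ; -1ℤ; _+_; _*_; -_; _-_; _^_)
import Data.Integer.Properties as ℤ
open import Data.Integer.Tactic.RingSolver using (solve-∀)
open import Data.Fin using (Fin; zero; suc; toℕ)
open import Data.Fin.Subset
  using (Subset; inside; outside; _∈_; _⊆_; ∣_∣; ⊤; ⊥; ∁; _∪_)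
open import Data.Fin.Subset.Properties
  using (_⊆?_; _∈?_; ⊆-refl; ⊆-trans; ⊥⊆; ⊆⊤; ∉⊥; ∈⊤; ∣⊥∣≡0; ∣⊤∣≡n; p⊆q⇒∣p∣≤∣q∣;
         drop-∷-⊆; out⊆; s⊆s; x∈⁅x⁆; x∈⁅y⁆⇒x≡y; x∈∁p⇒x∉p; x∉p⇒x∈∁p; ∣∁p∣≡n∸∣p∣;
         p∪∁p≡⊤; p⊆p∪q; q⊆p∪q; x∈p∪q⁺; x∈p∪q⁻)
open import Data.Vec using ([]; _∷_; here; there)
open import Data.List using (List; []; _∷_; [_]; _++_; map; foldr; filter)
import Data.List.Properties as List
import Data.List.Membership.Propositional as List
import Data.List.Relation.Unary.Any as Any
open import Data.List.Relation.Unary.All as All using (All; []; _∷_)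
open import Data.List.Relation.Unary.AllPairs using (_∷_)
open import Data.List.Relation.Unary.Unique.Propositional using (Unique)
open import Data.Product using (_,_)
open import Data.Sum using (inj₁; inj₂; [_,_]′)
open import Function using (_∘_)
open import Relation.Nullary using (Dec; yes; no; does; ¬_; contradiction; recompute)
open import Relation.Nullary.Decidable using (_×-dec_)
open import Relation.Unary using (Pred; Decidable)
open import Relation.Binary.PropositionalEquality
  using (_≡_; _≢_; refl; sym; trans; cong; cong₂; subst; module ≡-Reasoning)
open ≡-Reasoning

-- A closed form explains the identity. Write B(d,x)h for `binomSum d x h` and σ for (-1)ⁿ⁺ᵏ⁺¹. Let
-- γ(x) be the term of a face of size x at ζ̄ = 1, and β(x) its slope in ζ̄. Adding the facet that
-- omits i adds the faces that contain 0,...,i-1 but not i, and it changes ζ̄ on old faces; together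
-- Φ̌(n,k,i) is B(k-i,i)γ + σ B(i,k-i)β. Passing from k to k+1 keeps γ and β, but flips σ. Pascal's
-- rule in the first summand then gives the identity directly; in the second it makes σ B(i,k-i)β
-- cancel.
--
-- The encodings dictate the rest. Polynomials are formal sums, so they are compared coefficient by
-- coefficient; left multiplication changes the word that is read, so the recursions run on whole
-- coefficient functions `Word → ℤ`. Chains are listed under a bound on their number of steps. That
-- bound is the recursion variable of every formula, and it starts at `suc n` for all the complexes,
-- so it never has to be compared with actual chain lengths.

private variable
  A B : Set

-- Opaque, like ∑, so that unification sees ⟦ d ⟧ rather than its normal form.
opaque
  ⟦_⟧ : Dec A → ℤ
  ⟦ d ⟧ = if does d then 1ℤ else 0ℤ

  ⟦⟧-⇔ : (d : Dec A) (e : Dec B) → (A → B) → (B → A) → ⟦ d ⟧ ≡ ⟦ e ⟧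
  ⟦⟧-⇔ (yes p) (yes q) _ _ = refl
  ⟦⟧-⇔ (yes p) (no ¬q) f _ = contradiction (f p) ¬q
  ⟦⟧-⇔ (no ¬p) (yes q) _ g = contradiction (g q) ¬p
  ⟦⟧-⇔ (no ¬p) (no ¬q) _ _ = refl

  ⟦⟧-true : (d : Dec A) → A → ⟦ d ⟧ ≡ 1ℤ
  ⟦⟧-true (yes _) _ = refl
  ⟦⟧-true (no ¬p) p = contradiction p ¬p

  ⟦⟧-false : (d : Dec A) → ¬ A → ⟦ d ⟧ ≡ 0ℤ
  ⟦⟧-false (yes p) ¬p = contradiction p ¬p
  ⟦⟧-false (no _)  _  = refl

  ⟦⟧-× : (d : Dec A) (e : Dec B) → ⟦ d ×-dec e ⟧ ≡ ⟦ d ⟧ * ⟦ e ⟧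
  ⟦⟧-× (yes _) (yes _) = refl
  ⟦⟧-× (yes _) (no _)  = refl
  ⟦⟧-× (no _)  _       = refl

  ⟦⟧*-cong : (d : Dec A) {x y : ℤ} → (A → x ≡ y) → ⟦ d ⟧ * x ≡ ⟦ d ⟧ * y
  ⟦⟧*-cong (yes p) x≡y = cong (1ℤ *_) (x≡y p)
  ⟦⟧*-cong (no _)  _   = refl

-- Finite sums of integers

opaque
  ∑ : List A → (A → ℤ) → ℤ
  ∑ xs f = foldr _+_ 0ℤ (map f xs)

  ∑-[] : ∀ (f : A → ℤ) → ∑ [] f ≡ 0ℤ
  ∑-[] f = refl

  ∑-∷ : ∀ x xs (f : A → ℤ) → ∑ (x ∷ xs) f ≡ f x + ∑ xs f
  ∑-∷ x xs f = refl

  ∑-[-] : ∀ x (f : A → ℤ) → ∑ [ x ] f ≡ f x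
  ∑-[-] x f = ℤ.+-identityʳ (f x)

  ∑-cong : ∀ (xs : List A) {f g : A → ℤ} → (∀ x → f x ≡ g x) → ∑ xs f ≡ ∑ xs g
  ∑-cong []       f≡g = refl
  ∑-cong (x ∷ xs) f≡g = cong₂ _+_ (f≡g x) (∑-cong xs f≡g)

  ∑-zero : ∀ (xs : List A) {f : A → ℤ} → (∀ x → f x ≡ 0ℤ) → ∑ xs f ≡ 0ℤ
  ∑-zero []       f≡0 = refl
  ∑-zero (x ∷ xs) f≡0 = cong₂ _+_ (f≡0 x) (∑-zero xs f≡0)

  ∑-+ : ∀ (xs : List A) (f g : A → ℤ) → ∑ xs (λ x → f x + g x) ≡ ∑ xs f + ∑ xs g
  ∑-+ []       f g = refl
  ∑-+ (x ∷ xs) f g = trans (cong (f x + g x +_) (∑-+ xs f g))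
    (interchange (f x) (g x) (∑ xs f) (∑ xs g))
    where
    interchange : ∀ p q r s → (p + q) + (r + s) ≡ (p + r) + (q + s)
    interchange = solve-∀

  ∑-*ˡ : ∀ c (xs : List A) (f : A → ℤ) → ∑ xs (λ x → c * f x) ≡ c * ∑ xs f
  ∑-*ˡ c []       f = sym (ℤ.*-zeroʳ c)
  ∑-*ˡ c (x ∷ xs) f =
    trans (cong (c * f x +_) (∑-*ˡ c xs f)) (sym (ℤ.*-distribˡ-+ c (f x) (∑ xs f)))

  ∑-swap : ∀ (xs : List A) (ys : List B) (f : A → B → ℤ) →
           ∑ xs (λ x → ∑ ys (f x)) ≡ ∑ ys (λ y → ∑ xs (λ x → f x y))
  ∑-swap []       ys f = sym (∑-zero ys λ _ → refl)
  ∑-swap (x ∷ xs) ys f =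
    trans (cong (∑ ys (f x) +_) (∑-swap xs ys f)) (sym (∑-+ ys (f x) _))

  ∑-++ : ∀ (xs ys : List A) (f : A → ℤ) → ∑ (xs ++ ys) f ≡ ∑ xs f + ∑ ys f
  ∑-++ []       ys f = sym (ℤ.+-identityˡ _)
  ∑-++ (x ∷ xs) ys f = trans (cong (f x +_) (∑-++ xs ys f)) (sym (ℤ.+-assoc (f x) _ _))

  ∑-map : ∀ (g : A → B) xs (f : B → ℤ) → ∑ (map g xs) f ≡ ∑ xs (f ∘ g)
  ∑-map g []       f = refl
  ∑-map g (x ∷ xs) f = cong (f (g x) +_) (∑-map g xs f)

  ∑-filter : ∀ {Q : Pred A _} (Q? : Decidable Q) xs (f : A → ℤ) →
             foldr _+_ 0ℤ (map f (filter Q? xs)) ≡ ∑ xs (λ x → ⟦ Q? x ⟧ * f x)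
  ∑-filter Q? []       f = refl
  ∑-filter Q? (x ∷ xs) f with Q? x
  ... | yes q = cong₂ _+_
    (sym (trans (cong (_* f x) (⟦⟧-true (yes q) q)) (ℤ.*-identityˡ (f x)))) (∑-filter Q? xs f)
  ... | no ¬q = trans (∑-filter Q? xs f)
    (sym (trans (cong (λ e → e * f x + _) (⟦⟧-false (no ¬q) ¬q)) (ℤ.+-identityˡ _)))

∑-subsets : ∀ {m} (f : Subset (suc m) → ℤ) →
            ∑ (subsets (suc m)) f ≡
            ∑ (subsets m) (f ∘ (outside ∷_)) + ∑ (subsets m) (f ∘ (inside ∷_))
∑-subsets {m} f = begin
  ∑ (map (outside ∷_) s ++ (map (inside ∷_) s ++ [])) f
    ≡⟨ ∑-++ (map (outside ∷_) s) _ f ⟩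
  ∑ (map (outside ∷_) s) f + ∑ (map (inside ∷_) s ++ []) f
    ≡⟨ cong (λ l → ∑ (map (outside ∷_) s) f + ∑ l f) (List.++-identityʳ (map (inside ∷_) s)) ⟩
  ∑ (map (outside ∷_) s) f + ∑ (map (inside ∷_) s) f
    ≡⟨ cong₂ _+_ (∑-map (outside ∷_) s f) (∑-map (inside ∷_) s f) ⟩
  ∑ s (f ∘ (outside ∷_)) + ∑ s (f ∘ (inside ∷_)) ∎
  where s = subsets m

-- Coefficients of polynomials

coeff-∷ : ∀ c v p w → coeff ((c , v) ∷ p) w ≡ c * ⟦ List.≡-dec _≟ᴸ_ v w ⟧ + coeff p w
coeff-∷ c v p w with List.≡-dec _≟ᴸ_ v w
... | yes q = cong (_+ coeff p w)
  (sym (trans (cong (c *_) (⟦⟧-true (yes q) q)) (ℤ.*-identityʳ c)))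
... | no ¬q = sym (trans (cong (λ e → c * e + coeff p w) (⟦⟧-false (no ¬q) ¬q))
  (trans (cong (_+ coeff p w) (ℤ.*-zeroʳ c)) (ℤ.+-identityˡ _)))

coeff-+ᵖ : ∀ p q w → coeff (p +ᵖ q) w ≡ coeff p w + coeff q w
coeff-+ᵖ []            q w = sym (ℤ.+-identityˡ _)
coeff-+ᵖ ((c , v) ∷ p) q w = begin
  coeff ((c , v) ∷ p +ᵖ q) w            ≡⟨ coeff-∷ c v (p +ᵖ q) w ⟩
  t + coeff (p +ᵖ q) w                  ≡⟨ cong (t +_) (coeff-+ᵖ p q w) ⟩
  t + (coeff p w + coeff q w)           ≡⟨ ℤ.+-assoc t _ _ ⟨
  t + coeff p w + coeff q w             ≡⟨ cong (_+ coeff q w) (coeff-∷ c v p w) ⟨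
  coeff ((c , v) ∷ p) w + coeff q w     ∎
  where t = c * ⟦ List.≡-dec _≟ᴸ_ v w ⟧

coeff-·ᵖ : ∀ c p w → coeff (c ·ᵖ p) w ≡ c * coeff p w
coeff-·ᵖ c []            w = sym (ℤ.*-zeroʳ c)
coeff-·ᵖ c ((d , v) ∷ p) w = begin
  coeff ((c * d , v) ∷ c ·ᵖ p) w   ≡⟨ coeff-∷ (c * d) v _ w ⟩
  c * d * e + coeff (c ·ᵖ p) w     ≡⟨ cong (c * d * e +_) (coeff-·ᵖ c p w) ⟩
  c * d * e + c * coeff p w        ≡⟨ factor c d e (coeff p w) ⟩
  c * (d * e + coeff p w)          ≡⟨ cong (c *_) (coeff-∷ d v p w) ⟨
  c * coeff ((d , v) ∷ p) w        ∎
  where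
  e = ⟦ List.≡-dec _≟ᴸ_ v w ⟧
  factor : ∀ x y z t → x * y * z + x * t ≡ x * (y * z + t)
  factor = solve-∀

-- Left multiplication by a monomial and by a polynomial, on coefficient functions.
shift : Word → (Word → ℤ) → Word → ℤ
shift []      g w       = g w
shift (x ∷ v) g []      = 0ℤ
shift (x ∷ v) g (y ∷ w) = ⟦ x ≟ᴸ y ⟧ * shift v g w

act : Poly → (Word → ℤ) → Word → ℤ
act p g w = ∑ p (λ (c , v) → c * shift v g w)

shift-cong : ∀ v {g h} → (∀ w → g w ≡ h w) → ∀ w → shift v g w ≡ shift v h w
shift-cong []      g≡h w       = g≡h w
shift-cong (x ∷ v) g≡h []      = refl
shift-cong (x ∷ v) g≡h (y ∷ w) = cong (⟦ x ≟ᴸ y ⟧ *_) (shift-cong v g≡h w)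

-- At `c = 1ℤ` this is additivity; the general form is what a weighted sum needs when its terms are
-- peeled off one at a time.
shift-linear : ∀ v c g h w →
               shift v (λ u → c * g u + h u) w ≡ c * shift v g w + shift v h w
shift-linear []      c g h w       = refl
shift-linear (x ∷ v) c g h []      = sym (trans (ℤ.+-identityʳ _) (ℤ.*-zeroʳ c))
shift-linear (x ∷ v) c g h (y ∷ w) =
  trans (cong (⟦ x ≟ᴸ y ⟧ *_) (shift-linear v c g h w))
    (distrib ⟦ x ≟ᴸ y ⟧ c (shift v g w) (shift v h w))
  where
  distrib : ∀ e c p q → e * (c * p + q) ≡ c * (e * p) + e * q
  distrib = solve-∀

shift-zero : ∀ v w → shift v (λ _ → 0ℤ) w ≡ 0ℤ
shift-zero []      w       = refl
shift-zero (x ∷ v) []      = refl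
shift-zero (x ∷ v) (y ∷ w) =
  trans (cong (⟦ x ≟ᴸ y ⟧ *_) (shift-zero v w)) (ℤ.*-zeroʳ ⟦ x ≟ᴸ y ⟧)

act-cong : ∀ p {g h} → (∀ w → g w ≡ h w) → ∀ w → act p g w ≡ act p h w
act-cong p g≡h w = ∑-cong p λ (c , v) → cong (c *_) (shift-cong v g≡h w)

act-linear : ∀ p c g h w → act p (λ u → c * g u + h u) w ≡ c * act p g w + act p h w
act-linear p c g h w = begin
  ∑ p (λ (d , v) → d * shift v (λ u → c * g u + h u) w)
    ≡⟨ ∑-cong p (λ (d , v) → trans (cong (d *_) (shift-linear v c g h w))
                                  (distrib d c (shift v g w) (shift v h w))) ⟩
  ∑ p (λ (d , v) → c * (d * shift v g w) + d * shift v h w)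
    ≡⟨ ∑-+ p _ _ ⟩
  ∑ p (λ (d , v) → c * (d * shift v g w)) + act p h w
    ≡⟨ cong (_+ act p h w) (∑-*ˡ c p _) ⟩
  c * act p g w + act p h w ∎
  where
  distrib : ∀ d c x y → d * (c * x + y) ≡ c * (d * x) + d * y
  distrib = solve-∀

act-zero : ∀ p w → act p (λ _ → 0ℤ) w ≡ 0ℤ
act-zero p w = ∑-zero p λ (c , v) → trans (cong (c *_) (shift-zero v w)) (ℤ.*-zeroʳ c)

act-∑ : ∀ p (xs : List A) (c : A → ℤ) (g : A → Word → ℤ) w →
        act p (λ u → ∑ xs (λ x → c x * g x u)) w ≡ ∑ xs (λ x → c x * act p (g x) w)
act-∑ p []       c g w = begin
  act p (λ u → ∑ [] (λ x → c x * g x u)) w  ≡⟨ act-cong p (λ u → ∑-[] (λ x → c x * g x u)) w ⟩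
  act p (λ _ → 0ℤ) w                        ≡⟨ act-zero p w ⟩
  0ℤ                                        ≡⟨ ∑-[] (λ x → c x * act p (g x) w) ⟨
  ∑ [] (λ x → c x * act p (g x) w)          ∎
act-∑ p (x ∷ xs) c g w = begin
  act p (λ u → ∑ (x ∷ xs) (λ x → c x * g x u)) w
    ≡⟨ act-cong p (λ u → ∑-∷ x xs (λ x → c x * g x u)) w ⟩
  act p (λ u → c x * g x u + ∑ xs (λ x → c x * g x u)) w
    ≡⟨ act-linear p (c x) (g x) (λ u → ∑ xs (λ x → c x * g x u)) w ⟩
  c x * act p (g x) w + act p (λ u → ∑ xs (λ x → c x * g x u)) w
    ≡⟨ cong (c x * act p (g x) w +_) (act-∑ p xs c g w) ⟩
  c x * act p (g x) w + ∑ xs (λ x → c x * act p (g x) w)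
    ≡⟨ ∑-∷ x xs (λ x → c x * act p (g x) w) ⟨
  ∑ (x ∷ xs) (λ x → c x * act p (g x) w) ∎

shift-monomial : ∀ v u w → ⟦ List.≡-dec _≟ᴸ_ (v ++ u) w ⟧ ≡
                 shift v (λ w′ → ⟦ List.≡-dec _≟ᴸ_ u w′ ⟧) w
shift-monomial []      u w       = refl
shift-monomial (x ∷ v) u []      = ⟦⟧-false _ λ ()
shift-monomial (x ∷ v) u (y ∷ w) = begin
  ⟦ List.≡-dec _≟ᴸ_ (x ∷ v ++ u) (y ∷ w) ⟧
    ≡⟨ ⟦⟧-⇔ _ (x ≟ᴸ y ×-dec List.≡-dec _≟ᴸ_ (v ++ u) w) List.∷-injective
         (λ { (refl , refl) → refl }) ⟩
  ⟦ x ≟ᴸ y ×-dec List.≡-dec _≟ᴸ_ (v ++ u) w ⟧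
    ≡⟨ ⟦⟧-× (x ≟ᴸ y) _ ⟩
  ⟦ x ≟ᴸ y ⟧ * ⟦ List.≡-dec _≟ᴸ_ (v ++ u) w ⟧
    ≡⟨ cong (⟦ x ≟ᴸ y ⟧ *_) (shift-monomial v u w) ⟩
  ⟦ x ≟ᴸ y ⟧ * shift v _ w ∎

coeff-monomial-* : ∀ c v q w →
  coeff (map (λ (d , u) → c * d , v ++ u) q) w ≡ c * shift v (coeff q) w
coeff-monomial-* c v []            w = sym (trans (cong (c *_) (shift-zero v w)) (ℤ.*-zeroʳ c))
coeff-monomial-* c v ((d , u) ∷ q) w = begin
  coeff ((c * d , v ++ u) ∷ cvq) w
    ≡⟨ coeff-∷ (c * d) (v ++ u) cvq w ⟩
  c * d * ⟦ List.≡-dec _≟ᴸ_ (v ++ u) w ⟧ + coeff cvq w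
    ≡⟨ cong₂ (λ x y → c * d * x + y) (shift-monomial v u w) (coeff-monomial-* c v q w) ⟩
  c * d * shift v δ w + c * shift v (coeff q) w
    ≡⟨ factor c d (shift v δ w) (shift v (coeff q) w) ⟩
  c * (d * shift v δ w + shift v (coeff q) w)
    ≡⟨ cong (c *_) (shift-linear v d δ (coeff q) w) ⟨
  c * shift v (λ w′ → d * δ w′ + coeff q w′) w
    ≡⟨ cong (c *_) (shift-cong v (coeff-∷ d u q) w) ⟨
  c * shift v (coeff ((d , u) ∷ q)) w ∎
  where
  cvq = map (λ (d , u) → c * d , v ++ u) q
  δ = λ w′ → ⟦ List.≡-dec _≟ᴸ_ u w′ ⟧
  factor : ∀ c d x y → c * d * x + c * y ≡ c * (d * x + y)
  factor = solve-∀

coeff-*ᵖ : ∀ p q w → coeff (p *ᵖ q) w ≡ act p (coeff q) w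
coeff-*ᵖ []            q w = sym (∑-[] _)
coeff-*ᵖ ((c , v) ∷ p) q w = begin
  coeff (((c , v) ∷ p) *ᵖ q) w
    ≡⟨ coeff-+ᵖ (map (λ (d , u) → c * d , v ++ u) q) (p *ᵖ q) w ⟩
  coeff (map (λ (d , u) → c * d , v ++ u) q) w + coeff (p *ᵖ q) w
    ≡⟨ cong₂ _+_ (coeff-monomial-* c v q w) (coeff-*ᵖ p q w) ⟩
  c * shift v (coeff q) w + act p (coeff q) w
    ≡⟨ ∑-∷ (c , v) p (λ (c , v) → c * shift v (coeff q) w) ⟨
  act ((c , v) ∷ p) (coeff q) w ∎

-- Sums over chains

-- `step e` is the factor of a chain step of rank e + 1 that is not the last one. Since `*ᵖ`
-- associates to the left, it is literally the left factor in `weight`.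
𝐮^_ step : ℕ → Poly
𝐮^ e   = (𝐚 -ᵖ 𝐛) ^ᵖ e
step e = 𝐮^ e *ᵖ 𝐛

module _ (P : QuasiGradedPoset) where
  open QuasiGradedPoset P

  chainSum : ∀ {x z} → List (Chain P x z) → Word → ℤ
  chainSum cs = coeff (sumᵖ (map (weight P) cs))

  chainSum-++ : ∀ {x z} (cs ds : List (Chain P x z)) w →
                chainSum (cs ++ ds) w ≡ chainSum cs w + chainSum ds w
  chainSum-++ []       ds w = sym (ℤ.+-identityˡ _)
  chainSum-++ (c ∷ cs) ds w = begin
    coeff (weight P c +ᵖ _) w
      ≡⟨ coeff-+ᵖ (weight P c) _ w ⟩
    coeff (weight P c) w + chainSum (cs ++ ds) w
      ≡⟨ cong (coeff (weight P c) w +_) (chainSum-++ cs ds w) ⟩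
    coeff (weight P c) w + (chainSum cs w + chainSum ds w)
      ≡⟨ ℤ.+-assoc (coeff (weight P c) w) _ _ ⟨
    coeff (weight P c) w + chainSum cs w + chainSum ds w
      ≡⟨ cong (_+ chainSum ds w) (coeff-+ᵖ (weight P c) _ w) ⟨
    chainSum (c ∷ cs) w + chainSum ds w ∎

  chainSum-∷ᶜ : ∀ {x y z} .(x≺y : x ≺ y) (cs : List (Chain P y z)) w →
    chainSum (map (x≺y ∷ᶜ_) cs) w ≡ ζ̄ x y * act (step (ρ[ x , y ] ∸ 1)) (chainSum cs) w
  chainSum-∷ᶜ {x} {y} x≺y []       w =
    sym (trans (cong (ζ̄ x y *_) (act-zero (step (ρ[ x , y ] ∸ 1)) w)) (ℤ.*-zeroʳ (ζ̄ x y)))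
  chainSum-∷ᶜ {x} {y} x≺y (c ∷ cs) w = begin
    coeff (ζ̄ x y ·ᵖ (s *ᵖ weight P c) +ᵖ _) w
      ≡⟨ coeff-+ᵖ (ζ̄ x y ·ᵖ (s *ᵖ weight P c)) _ w ⟩
    coeff (ζ̄ x y ·ᵖ (s *ᵖ weight P c)) w + chainSum (map (x≺y ∷ᶜ_) cs) w
      ≡⟨ cong₂ _+_
           (trans (coeff-·ᵖ (ζ̄ x y) (s *ᵖ weight P c) w) (cong (ζ̄ x y *_) (coeff-*ᵖ s (weight P c) w)))
           (chainSum-∷ᶜ x≺y cs w) ⟩
    ζ̄ x y * act s (coeff (weight P c)) w + ζ̄ x y * act s (chainSum cs) w
      ≡⟨ factor (ζ̄ x y) (act s (coeff (weight P c)) w) (act s (chainSum cs) w) ⟩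
    ζ̄ x y * (1ℤ * act s (coeff (weight P c)) w + act s (chainSum cs) w)
      ≡⟨ cong (ζ̄ x y *_) (act-linear s 1ℤ (coeff (weight P c)) (chainSum cs) w) ⟨
    ζ̄ x y * act s (λ u → 1ℤ * coeff (weight P c) u + chainSum cs u) w
      ≡⟨ cong (ζ̄ x y *_) (act-cong s (λ u →
           trans (cong (_+ chainSum cs u) (ℤ.*-identityˡ (coeff (weight P c) u)))
             (sym (coeff-+ᵖ (weight P c) (sumᵖ (map (weight P) cs)) u))) w) ⟩
    ζ̄ x y * act s (chainSum (c ∷ cs)) w ∎
    where
    s = step (ρ[ x , y ] ∸ 1)
    factor : ∀ c x y → c * x + c * y ≡ c * (1ℤ * x + y)
    factor = solve-∀

  Ψ[_] : ℕ → Carrier → Carrier → Word → ℤ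
  Ψ[ k ] x z = chainSum (chains P k x z)

  chainSum-direct : ∀ x z w →
    chainSum (direct P x z) w ≡ ⟦ x ≺? z ⟧ * (ζ̄ x z * coeff (𝐮^ (ρ[ x , z ] ∸ 1)) w)
  chainSum-direct x z w with x ≺? z
  ... | no x⊀z  = sym (cong
    (_* (ζ̄ x z * coeff (𝐮^ (ρ[ x , z ] ∸ 1)) w)) (⟦⟧-false (no x⊀z) x⊀z))
  ... | yes x≺z = begin
    coeff (ζ̄ x z ·ᵖ p +ᵖ 0ᵖ) w          ≡⟨ coeff-+ᵖ (ζ̄ x z ·ᵖ p) 0ᵖ w ⟩
    coeff (ζ̄ x z ·ᵖ p) w + 0ℤ           ≡⟨ ℤ.+-identityʳ _ ⟩
    coeff (ζ̄ x z ·ᵖ p) w                ≡⟨ coeff-·ᵖ (ζ̄ x z) p w ⟩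
    ζ̄ x z * coeff p w                   ≡⟨ ℤ.*-identityˡ _ ⟨
    1ℤ * (ζ̄ x z * coeff p w)            ≡⟨ cong (_* (ζ̄ x z * coeff p w)) (⟦⟧-true (yes x≺z) x≺z) ⟨
    ⟦ yes x≺z ⟧ * (ζ̄ x z * coeff p w)   ∎
    where p = 𝐮^ (ρ[ x , z ] ∸ 1)

  -- The share of the chains whose first step ends at `y`. The indicator replaces the case split of
  -- `chains-via`, so that `y` can run over all elements.
  next : ℕ → ∀ x z → Word → Carrier → ℤ
  next k x z w y = ⟦ x ≺? y ⟧ * (ζ̄ x y * act (step (ρ[ x , y ] ∸ 1)) (Ψ[ k ] y z) w)

  chainSum-via : ∀ k x z ys w →
                 chainSum (chains-via P k x z ys) w ≡ ∑ ys (next k x z w)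
  chainSum-via k x z []       w = sym (∑-[] (next k x z w))
  chainSum-via k x z (y ∷ ys) w = begin
    chainSum (chains-via P k x z (y ∷ ys)) w  ≡⟨ via-∷ ⟩
    next k x z w y + chainSum vs w            ≡⟨ cong (next k x z w y +_) (chainSum-via k x z ys w) ⟩
    next k x z w y + ∑ ys (next k x z w)      ≡⟨ ∑-∷ y ys (next k x z w) ⟨
    ∑ (y ∷ ys) (next k x z w)                 ∎
    where
    vs = chains-via P k x z ys
    via-∷ : chainSum (chains-via P k x z (y ∷ ys)) w ≡ next k x z w y + chainSum vs w
    via-∷ with x ≺? y
    ... | no x⊀y  = begin
      chainSum vs w                 ≡⟨ ℤ.+-identityˡ (chainSum vs w) ⟨
      0ℤ * t + chainSum vs w        ≡⟨ cong (λ e → e * t + chainSum vs w) (⟦⟧-false (no x⊀y) x⊀y) ⟨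
      ⟦ no x⊀y ⟧ * t + chainSum vs w ∎
      where
      t = ζ̄ x y * act (step (ρ[ x , y ] ∸ 1)) (Ψ[ k ] y z) w
    ... | yes x≺y = begin
      chainSum (map (x≺y ∷ᶜ_) (chains P k y z) ++ vs) w
        ≡⟨ chainSum-++ (map (x≺y ∷ᶜ_) (chains P k y z)) vs w ⟩
      chainSum (map (x≺y ∷ᶜ_) (chains P k y z)) w + chainSum vs w
        ≡⟨ cong (_+ chainSum vs w) (chainSum-∷ᶜ x≺y (chains P k y z) w) ⟩
      t + chainSum vs w
        ≡⟨ cong (_+ chainSum vs w) (ℤ.*-identityˡ t) ⟨
      1ℤ * t + chainSum vs w
        ≡⟨ cong (λ e → e * t + chainSum vs w) (⟦⟧-true (yes x≺y) x≺y) ⟨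
      ⟦ yes x≺y ⟧ * t + chainSum vs w ∎
      where
      t = ζ̄ x y * act (step (ρ[ x , y ] ∸ 1)) (Ψ[ k ] y z) w

  Ψ-suc : ∀ k x z w → Ψ[ suc k ] x z w ≡
    ⟦ x ≺? z ⟧ * (ζ̄ x z * coeff (𝐮^ (ρ[ x , z ] ∸ 1)) w) + ∑ elements (next k x z w)
  Ψ-suc k x z w = trans (chainSum-++ (direct P x z) (chains-via P k x z elements) w)
    (cong₂ _+_ (chainSum-direct x z w) (chainSum-via k x z elements w))

-- Sums over subsets

⟦⟧-¬ : (d : Dec A) (e : Dec B) → (A → ¬ B) → (¬ A → B) → ⟦ d ⟧ ≡ 1ℤ - ⟦ e ⟧
⟦⟧-¬ (yes p) e f _ = trans (⟦⟧-true _ p) (cong (λ x → 1ℤ - x) (sym (⟦⟧-false e (f p))))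
⟦⟧-¬ (no ¬p) e _ g = trans (⟦⟧-false _ ¬p) (cong (λ x → 1ℤ - x) (sym (⟦⟧-true e (g ¬p))))

⟦out⊆⟧ : ∀ {m} s (F G : Subset m) → ⟦ outside ∷ F ⊆? s ∷ G ⟧ ≡ ⟦ F ⊆? G ⟧
⟦out⊆⟧ s F G = ⟦⟧-⇔ (outside ∷ F ⊆? s ∷ G) (F ⊆? G) drop-∷-⊆ out⊆

⟦in⊆in⟧ : ∀ {m} (F G : Subset m) → ⟦ inside ∷ F ⊆? inside ∷ G ⟧ ≡ ⟦ F ⊆? G ⟧
⟦in⊆in⟧ F G = ⟦⟧-⇔ (inside ∷ F ⊆? inside ∷ G) (F ⊆? G) drop-∷-⊆ s⊆s

⟦in⊆out⟧ : ∀ {m} (F G : Subset m) → ⟦ inside ∷ F ⊆? outside ∷ G ⟧ ≡ 0ℤ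
⟦in⊆out⟧ F G = ⟦⟧-false (inside ∷ F ⊆? outside ∷ G) λ F⊆G → contradiction (F⊆G here) λ ()

⟦∪⊆⟧ : ∀ {m} (F G H : Subset m) → ⟦ F ⊆? H ⟧ * ⟦ G ⊆? H ⟧ ≡ ⟦ F ∪ G ⊆? H ⟧
⟦∪⊆⟧ F G H = trans (sym (⟦⟧-× (F ⊆? H) (G ⊆? H))) (⟦⟧-⇔ (F ⊆? H ×-dec G ⊆? H) (F ∪ G ⊆? H)
  (λ (F⊆H , G⊆H) x∈ → [ F⊆H , G⊆H ]′ (x∈p∪q⁻ F G x∈))
  (λ ∪⊆H → ⊆-trans (p⊆p∪q G) ∪⊆H , ⊆-trans (q⊆p∪q F G) ∪⊆H))

-- binomSum d x h = ∑ₜ C(d,t) h(x + t), the sum of h ∣ G ∣ over all sets G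
-- between two given sets of sizes x and x + d.
binomSum : ℕ → ℕ → (ℕ → ℤ) → ℤ
binomSum zero    x h = h x
binomSum (suc d) x h = binomSum d x h + binomSum d (suc x) h

binomSum-∘suc : ∀ d x h → binomSum d x (h ∘ suc) ≡ binomSum d (suc x) h
binomSum-∘suc zero    x h = refl
binomSum-∘suc (suc d) x h = cong₂ _+_ (binomSum-∘suc d x h) (binomSum-∘suc d (suc x) h)

binomSum-linear : ∀ d x c {f g h : ℕ → ℤ} → (∀ z → f z ≡ c * g z + h z) →
                  binomSum d x f ≡ c * binomSum d x g + binomSum d x h
binomSum-linear zero    x c         f≡ = f≡ x
binomSum-linear (suc d) x c {f} {g} {h} f≡ =
  trans (cong₂ _+_ (binomSum-linear d x c f≡) (binomSum-linear d (suc x) c f≡))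
        (collect c (binomSum d x g) (binomSum d x h) (binomSum d (suc x) g) (binomSum d (suc x) h))
  where
  collect : ∀ c p q r s → c * p + q + (c * r + s) ≡ c * (p + r) + (q + s)
  collect = solve-∀

-- Induction on the ground set. An element of `H` outside `F` is free and gives one Pascal step; an
-- element of both shifts `h` by one; an element of neither is excluded from `G`; an element of `F`
-- outside `H` makes both sides 0.
∑-interval : ∀ {m} (F H : Subset m) h →
  ∑ (subsets m) (λ G → ⟦ F ⊆? G ⟧ * (⟦ G ⊆? H ⟧ * h ∣ G ∣)) ≡
  ⟦ F ⊆? H ⟧ * binomSum (∣ H ∣ ∸ ∣ F ∣) (∣ F ∣) h
∑-interval []            []            h = begin
  ∑ [ [] ] _
    ≡⟨ ∑-[-] [] _ ⟩
  ⟦ [] ⊆? [] ⟧ * (⟦ [] ⊆? [] ⟧ * h 0)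
    ≡⟨ cong (λ e → ⟦ [] ⊆? [] ⟧ * (e * h 0)) (⟦⟧-true ([] ⊆? []) ⊆-refl) ⟩
  ⟦ [] ⊆? [] ⟧ * (1ℤ * h 0)
    ≡⟨ cong (⟦ [] ⊆? [] ⟧ *_) (ℤ.*-identityˡ (h 0)) ⟩
  ⟦ [] ⊆? [] ⟧ * h 0 ∎
∑-interval {suc m} (outside ∷ F) (outside ∷ H) h = begin
  ∑ (subsets (suc m)) _ ≡⟨ ∑-subsets _ ⟩
  ∑ (subsets m) _ + ∑ (subsets m) _
    ≡⟨ cong₂ _+_
         (∑-cong (subsets m) λ G → cong₂ (λ x y → x * (y * h ∣ G ∣))
           (⟦out⊆⟧ outside F G) (⟦out⊆⟧ outside G H))
         (∑-zero (subsets m) λ G → trans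
           (cong (λ y → ⟦ outside ∷ F ⊆? inside ∷ G ⟧ * (y * h (suc ∣ G ∣))) (⟦in⊆out⟧ G H))
           (ℤ.*-zeroʳ ⟦ outside ∷ F ⊆? inside ∷ G ⟧)) ⟩
  ∑ (subsets m) (λ G → ⟦ F ⊆? G ⟧ * (⟦ G ⊆? H ⟧ * h ∣ G ∣)) + 0ℤ
    ≡⟨ ℤ.+-identityʳ _ ⟩
  ∑ (subsets m) (λ G → ⟦ F ⊆? G ⟧ * (⟦ G ⊆? H ⟧ * h ∣ G ∣))
    ≡⟨ ∑-interval F H h ⟩
  ⟦ F ⊆? H ⟧ * binomSum (∣ H ∣ ∸ ∣ F ∣) (∣ F ∣) h
    ≡⟨ cong (_* binomSum (∣ H ∣ ∸ ∣ F ∣) (∣ F ∣) h) (⟦out⊆⟧ outside F H) ⟨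
  ⟦ outside ∷ F ⊆? outside ∷ H ⟧ * binomSum (∣ H ∣ ∸ ∣ F ∣) (∣ F ∣) h ∎
∑-interval {suc m} (outside ∷ F) (inside ∷ H) h = begin
  ∑ (subsets (suc m)) _ ≡⟨ ∑-subsets _ ⟩
  ∑ (subsets m) _ + ∑ (subsets m) _
    ≡⟨ cong₂ _+_
         (∑-cong (subsets m) λ G → cong₂ (λ x y → x * (y * h ∣ G ∣))
           (⟦out⊆⟧ outside F G) (⟦out⊆⟧ inside G H))
         (∑-cong (subsets m) λ G → cong₂ (λ x y → x * (y * h (suc ∣ G ∣)))
           (⟦out⊆⟧ inside F G) (⟦in⊆in⟧ G H)) ⟩
  ∑ (subsets m) (λ G → ⟦ F ⊆? G ⟧ * (⟦ G ⊆? H ⟧ * h ∣ G ∣)) +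
  ∑ (subsets m) (λ G → ⟦ F ⊆? G ⟧ * (⟦ G ⊆? H ⟧ * h (suc ∣ G ∣)))
    ≡⟨ cong₂ _+_ (∑-interval F H h) (∑-interval F H (h ∘ suc)) ⟩
  ⟦ F ⊆? H ⟧ * binomSum d (∣ F ∣) h + ⟦ F ⊆? H ⟧ * binomSum d (∣ F ∣) (h ∘ suc)
    ≡⟨ ℤ.*-distribˡ-+ ⟦ F ⊆? H ⟧ (binomSum d (∣ F ∣) h) _ ⟨
  ⟦ F ⊆? H ⟧ * (binomSum d (∣ F ∣) h + binomSum d (∣ F ∣) (h ∘ suc))
    ≡⟨ cong (λ y → ⟦ F ⊆? H ⟧ * (binomSum d (∣ F ∣) h + y)) (binomSum-∘suc d (∣ F ∣) h) ⟩
  ⟦ F ⊆? H ⟧ * binomSum (suc d) (∣ F ∣) h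
    -- Truncated subtraction commutes with `suc` only if ∣F∣ ≤ ∣H∣; the indicator in front supplies
    -- this.
    ≡⟨ ⟦⟧*-cong (F ⊆? H) (λ F⊆H →
         cong (λ e → binomSum e (∣ F ∣) h) (sym (ℕ.+-∸-assoc 1 (p⊆q⇒∣p∣≤∣q∣ F⊆H)))) ⟩
  ⟦ F ⊆? H ⟧ * binomSum (suc ∣ H ∣ ∸ ∣ F ∣) (∣ F ∣) h
    ≡⟨ cong (_* binomSum (suc ∣ H ∣ ∸ ∣ F ∣) (∣ F ∣) h) (⟦out⊆⟧ inside F H) ⟨
  ⟦ outside ∷ F ⊆? inside ∷ H ⟧ * binomSum (suc ∣ H ∣ ∸ ∣ F ∣) (∣ F ∣) h ∎
  where d = ∣ H ∣ ∸ ∣ F ∣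
∑-interval {suc m} (inside ∷ F) (outside ∷ H) h = begin
  ∑ (subsets (suc m)) _ ≡⟨ ∑-subsets _ ⟩
  ∑ (subsets m) _ + ∑ (subsets m) _
    ≡⟨ cong₂ _+_
         (∑-zero (subsets m) λ G →
           cong (_* (⟦ outside ∷ G ⊆? outside ∷ H ⟧ * h ∣ G ∣)) (⟦in⊆out⟧ F G))
         (∑-zero (subsets m) λ G → trans
           (cong (λ y → ⟦ inside ∷ F ⊆? inside ∷ G ⟧ * (y * h (suc ∣ G ∣))) (⟦in⊆out⟧ G H))
           (ℤ.*-zeroʳ ⟦ inside ∷ F ⊆? inside ∷ G ⟧)) ⟩
  0ℤ
    ≡⟨ cong (_* binomSum (∣ H ∣ ∸ suc ∣ F ∣) (suc ∣ F ∣) h) (⟦in⊆out⟧ F H) ⟨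
  ⟦ inside ∷ F ⊆? outside ∷ H ⟧ * binomSum (∣ H ∣ ∸ suc ∣ F ∣) (suc ∣ F ∣) h ∎
∑-interval {suc m} (inside ∷ F) (inside ∷ H) h = begin
  ∑ (subsets (suc m)) _ ≡⟨ ∑-subsets _ ⟩
  ∑ (subsets m) _ + ∑ (subsets m) _
    ≡⟨ cong₂ _+_
         (∑-zero (subsets m) λ G →
           cong (_* (⟦ outside ∷ G ⊆? inside ∷ H ⟧ * h ∣ G ∣)) (⟦in⊆out⟧ F G))
         (∑-cong (subsets m) λ G → cong₂ (λ x y → x * (y * h (suc ∣ G ∣)))
           (⟦in⊆in⟧ F G) (⟦in⊆in⟧ G H)) ⟩
  0ℤ + ∑ (subsets m) (λ G → ⟦ F ⊆? G ⟧ * (⟦ G ⊆? H ⟧ * h (suc ∣ G ∣)))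
    ≡⟨ ℤ.+-identityˡ _ ⟩
  ∑ (subsets m) (λ G → ⟦ F ⊆? G ⟧ * (⟦ G ⊆? H ⟧ * h (suc ∣ G ∣)))
    ≡⟨ ∑-interval F H (h ∘ suc) ⟩
  ⟦ F ⊆? H ⟧ * binomSum (∣ H ∣ ∸ ∣ F ∣) (∣ F ∣) (h ∘ suc)
    ≡⟨ cong₂ _*_ (sym (⟦in⊆in⟧ F H)) (binomSum-∘suc (∣ H ∣ ∸ ∣ F ∣) (∣ F ∣) h) ⟩
  ⟦ inside ∷ F ⊆? inside ∷ H ⟧ * binomSum (∣ H ∣ ∸ ∣ F ∣) (suc ∣ F ∣) h ∎

∑-supersets : ∀ {m} (F : Subset m) h →
  ∑ (subsets m) (λ G → ⟦ F ⊆? G ⟧ * h ∣ G ∣) ≡ binomSum (m ∸ ∣ F ∣) (∣ F ∣) h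
∑-supersets {m} F h = begin
  ∑ (subsets m) (λ G → ⟦ F ⊆? G ⟧ * h ∣ G ∣)
    ≡⟨ ∑-cong (subsets m) (λ G → cong (⟦ F ⊆? G ⟧ *_)
         (trans (sym (ℤ.*-identityˡ (h ∣ G ∣)))
                (cong (_* h ∣ G ∣) (sym (⟦⟧-true (G ⊆? ⊤) ⊆⊤))))) ⟩
  ∑ (subsets m) (λ G → ⟦ F ⊆? G ⟧ * (⟦ G ⊆? ⊤ ⟧ * h ∣ G ∣))
    ≡⟨ ∑-interval F ⊤ h ⟩
  ⟦ F ⊆? ⊤ ⟧ * binomSum (∣ ⊤ {m} ∣ ∸ ∣ F ∣) (∣ F ∣) h
    ≡⟨ cong₂ (λ x e → x * binomSum (e ∸ ∣ F ∣) (∣ F ∣) h) (⟦⟧-true (F ⊆? ⊤) ⊆⊤) (∣⊤∣≡n m) ⟩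
  1ℤ * binomSum (m ∸ ∣ F ∣) (∣ F ∣) h
    ≡⟨ ℤ.*-identityˡ _ ⟩
  binomSum (m ∸ ∣ F ∣) (∣ F ∣) h ∎

-- Signs and alternating sums over supersets

sgn : ℕ → ℤ
sgn k = -1ℤ ^ k

sgn²≡1 : ∀ k → sgn k * sgn k ≡ 1ℤ
sgn²≡1 zero    = refl
sgn²≡1 (suc k) = trans (square (sgn k)) (sgn²≡1 k)
  where
  square : ∀ x → (-1ℤ * x) * (-1ℤ * x) ≡ x * x
  square = solve-∀

sgn-∸ : ∀ {j k} → j ≤ k → sgn (k ∸ j) ≡ sgn k * sgn j
sgn-∸ {zero}  {k}     z≤n       = sym (ℤ.*-identityʳ (sgn k))
sgn-∸ {suc j} {suc k} (s≤s j≤k) = trans (sgn-∸ j≤k) (cancel (sgn k) (sgn j))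
  where
  cancel : ∀ x y → x * y ≡ (-1ℤ * x) * (-1ℤ * y)
  cancel = solve-∀

-- `-1^_` uses the absolute value: lowering a positive `z` shortens the exponent, lowering any other
-- `z` lengthens it. The parity changes either way.
1^-pred : ∀ z → -1^ (z - 1ℤ) ≡ - (-1^ z)
1^-pred (ℤ.+ zero)    = refl
1^-pred (ℤ.+ (suc k)) = trans (cong -1^_ (ℤ.⊖-≥ {suc k} {1} (s≤s z≤n))) (neg² (sgn k))
  where
  neg² : ∀ x → x ≡ - (-1ℤ * x)
  neg² = solve-∀
1^-pred (ℤ.-[1+ k ])  = trans (cong (λ e → sgn (suc (suc e))) (ℕ.+-identityʳ k)) (neg² (sgn (suc k)))
  where
  neg² : ∀ x → -1ℤ * x ≡ - x
  neg² = solve-∀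

-- The exponent is -1 for `H = F`, the empty face of the link. The final -1 is therefore split off
-- as a sign before passing to natural numbers.
1^-dim : ∀ {m} {F H : Subset m} → F ⊆ H →
         -1^ (dim H - dim F - 1ℤ) ≡ - (sgn ∣ F ∣ * sgn ∣ H ∣)
1^-dim {F = F} {H} F⊆H = begin
  -1^ (dim H - dim F - 1ℤ)
    ≡⟨ 1^-pred (dim H - dim F) ⟩
  - (-1^ (dim H - dim F))
    ≡⟨ cong (λ z → - (-1^ z)) dim-diff ⟩
  - sgn (∣ H ∣ ∸ ∣ F ∣)
    ≡⟨ cong -_ (trans (sgn-∸ (p⊆q⇒∣p∣≤∣q∣ F⊆H)) (ℤ.*-comm (sgn ∣ H ∣) (sgn ∣ F ∣))) ⟩
  - (sgn ∣ F ∣ * sgn ∣ H ∣) ∎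
  where
  shift-cancel : ∀ x y → (x - 1ℤ) - (y - 1ℤ) ≡ x - y
  shift-cancel = solve-∀
  dim-diff : dim H - dim F ≡ ℤ.+ (∣ H ∣ ∸ ∣ F ∣)
  dim-diff = begin
    dim H - dim F
      ≡⟨ cong₂ _-_ (ℤ.m-n≡m⊖n ∣ H ∣ 1) (ℤ.m-n≡m⊖n ∣ F ∣ 1) ⟨
    (ℤ.+ ∣ H ∣ - 1ℤ) - (ℤ.+ ∣ F ∣ - 1ℤ)
      ≡⟨ shift-cancel (ℤ.+ ∣ H ∣) (ℤ.+ ∣ F ∣) ⟩
    ℤ.+ ∣ H ∣ - ℤ.+ ∣ F ∣
      ≡⟨ ℤ.m-n≡m⊖n ∣ H ∣ ∣ F ∣ ⟩
    ∣ H ∣ ℤ.⊖ ∣ F ∣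
      ≡⟨ ℤ.⊖-≥ (p⊆q⇒∣p∣≤∣q∣ F⊆H) ⟩
    ℤ.+ (∣ H ∣ ∸ ∣ F ∣) ∎

-- Toggling an element outside `F` pairs off the supersets with opposite signs, so only `F = ⊤`
-- leaves a term.
∑-supersets-sgn : ∀ {m} (F : Subset m) →
  ∑ (subsets m) (λ H → ⟦ F ⊆? H ⟧ * sgn ∣ H ∣) ≡ ⟦ ⊤ ⊆? F ⟧ * sgn m
∑-supersets-sgn []            = trans (∑-[-] [] _)
  (cong (_* 1ℤ) (⟦⟧-⇔ ([] ⊆? []) (⊤ ⊆? []) (λ _ → ⊆-refl) (λ _ → ⊆-refl)))
∑-supersets-sgn {suc m} (outside ∷ F) = begin
  ∑ (subsets (suc m)) _
    ≡⟨ ∑-subsets _ ⟩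
  ∑ (subsets m) _ + ∑ (subsets m) _
    ≡⟨ cong₂ _+_
         (∑-cong (subsets m) λ H → cong (_* sgn ∣ H ∣) (⟦out⊆⟧ outside F H))
         (trans (∑-cong (subsets m) λ H → trans (cong (_* (-1ℤ * sgn ∣ H ∣)) (⟦out⊆⟧ inside F H))
                                                (pull ⟦ F ⊆? H ⟧ (sgn ∣ H ∣)))
                (∑-*ˡ -1ℤ (subsets m) _)) ⟩
  s + -1ℤ * s
    ≡⟨ vanish s ⟩
  0ℤ
    ≡⟨ cong (_* sgn (suc m)) (⟦in⊆out⟧ ⊤ F) ⟨
  ⟦ ⊤ ⊆? outside ∷ F ⟧ * sgn (suc m) ∎
  where
  s = ∑ (subsets m) λ H → ⟦ F ⊆? H ⟧ * sgn ∣ H ∣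
  pull : ∀ x y → x * (-1ℤ * y) ≡ -1ℤ * (x * y)
  pull = solve-∀
  vanish : ∀ x → x + -1ℤ * x ≡ 0ℤ
  vanish = solve-∀
∑-supersets-sgn {suc m} (inside ∷ F) = begin
  ∑ (subsets (suc m)) _
    ≡⟨ ∑-subsets _ ⟩
  ∑ (subsets m) _ + ∑ (subsets m) _
    ≡⟨ cong₂ _+_
         (∑-zero (subsets m) λ H → cong (_* sgn ∣ H ∣) (⟦in⊆out⟧ F H))
         (trans (∑-cong (subsets m) λ H → trans (cong (_* (-1ℤ * sgn ∣ H ∣)) (⟦in⊆in⟧ F H))
                                                (pull ⟦ F ⊆? H ⟧ (sgn ∣ H ∣)))
                (∑-*ˡ -1ℤ (subsets m) _)) ⟩
  0ℤ + -1ℤ * ∑ (subsets m) (λ H → ⟦ F ⊆? H ⟧ * sgn ∣ H ∣)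
    ≡⟨ cong (λ s → 0ℤ + -1ℤ * s) (∑-supersets-sgn F) ⟩
  0ℤ + -1ℤ * (⟦ ⊤ ⊆? F ⟧ * sgn m)
    ≡⟨ push ⟦ ⊤ ⊆? F ⟧ (sgn m) ⟩
  ⟦ ⊤ ⊆? F ⟧ * sgn (suc m)
    ≡⟨ cong (_* sgn (suc m)) (⟦in⊆in⟧ ⊤ F) ⟨
  ⟦ ⊤ ⊆? inside ∷ F ⟧ * sgn (suc m) ∎
  where
  pull : ∀ x y → x * (-1ℤ * y) ≡ -1ℤ * (x * y)
  pull = solve-∀
  push : ∀ x y → 0ℤ + -1ℤ * (x * y) ≡ x * (-1ℤ * y)
  push = solve-∀

-- Faces and links of the complexes `Δ[ k , i ]`

initial : ℕ → ∀ m → Subset m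
initial zero    m       = ⊥
initial (suc j) zero    = []
initial (suc j) (suc m) = inside ∷ initial j m

∣initial∣ : ∀ {j m} → j ≤ m → ∣ initial j m ∣ ≡ j
∣initial∣ {m = m} z≤n = ∣⊥∣≡0 m
∣initial∣ (s≤s j≤m)   = cong suc (∣initial∣ j≤m)

∈initial⁺ : ∀ {j m} {x : Fin m} → toℕ x < j → x ∈ initial j m
∈initial⁺ {suc j} {x = zero}  _         = here
∈initial⁺ {suc j} {x = suc x} (s≤s x<j) = there (∈initial⁺ x<j)

∈initial⁻ : ∀ {j m} {x : Fin m} → x ∈ initial j m → toℕ x < j
∈initial⁻ {zero}              x∈         = contradiction x∈ ∉⊥
∈initial⁻ {suc j} {x = zero}  _          = s≤s z≤n
∈initial⁻ {suc j} {x = suc x} (there x∈) = s≤s (∈initial⁻ x∈)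

module _ (k i : ℕ) where
  open SimplicialComplex Δ[ k , i ]

  omitted : Subset (suc k)
  omitted = initial (suc i) (suc k)

  face⇒⊉ : ∀ {F} → IsFace F → ¬ omitted ⊆ F
  face⇒⊉ (j , j≤i , F⊆) omitted⊆F = x∈∁p⇒x∉p (F⊆ (omitted⊆F (∈initial⁺ (s≤s j≤i)))) (x∈⁅x⁆ j)

  nonface⇒⊇ : ∀ {F} → ¬ IsFace F → omitted ⊆ F
  nonface⇒⊇ {F} ¬face {x} x∈omitted with x ∈? F
  ... | yes x∈F = x∈F
  ... | no  x∉F = contradiction
    (x , ℕ.s≤s⁻¹ (∈initial⁻ x∈omitted) , λ {y} y∈F → x∉p⇒x∈∁p λ y∈ →
      x∉F (subst (_∈ F) (x∈⁅y⁆⇒x≡y x y∈) y∈F))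
    ¬face

  -- Lying in a generating facet means missing one of the omitted vertices. This turns sums over
  -- faces into differences of sums over supersets.
  ⟦isFace⟧ : ∀ F → ⟦ isFace? F ⟧ ≡ 1ℤ - ⟦ omitted ⊆? F ⟧
  ⟦isFace⟧ F = ⟦⟧-¬ (isFace? F) (omitted ⊆? F) face⇒⊉ nonface⇒⊇

  -- The link of `F` is a cone unless `F` contains `∁ omitted`; then it is the boundary of the
  -- simplex on the omitted vertices outside `F`. In the computation, the supersets of `F`
  -- contribute 0 because a face is not `⊤`, and the supersets of `omitted ∪ F` contribute only if
  -- that union is `⊤`.
  χ̃-link≡ : ∀ {F} → IsFace F →
    χ̃-link Δ[ k , i ] F ≡ sgn ∣ F ∣ * (sgn (suc k) * ⟦ ∁ omitted ⊆? F ⟧)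
  χ̃-link≡ {F} F∈Δ = begin
    χ̃-link Δ[ k , i ] F
      ≡⟨ ∑-filter (λ H → isFace? H ×-dec (F ⊆? H)) ss _ ⟩
    ∑ ss (λ H → ⟦ isFace? H ×-dec (F ⊆? H) ⟧ * -1^ (dim H - dim F - 1ℤ))
      ≡⟨ ∑-cong ss summand ⟩
    ∑ ss (λ H → sgn ∣ F ∣ * (⟦ omitted ∪ F ⊆? H ⟧ * sgn ∣ H ∣ + -1ℤ * (⟦ F ⊆? H ⟧ * sgn ∣ H ∣)))
      ≡⟨ ∑-*ˡ (sgn ∣ F ∣) ss _ ⟩
    sgn ∣ F ∣ * ∑ ss (λ H → ⟦ omitted ∪ F ⊆? H ⟧ * sgn ∣ H ∣ + -1ℤ * (⟦ F ⊆? H ⟧ * sgn ∣ H ∣))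
      ≡⟨ cong (sgn ∣ F ∣ *_) (trans (∑-+ ss _ _) (cong₂ _+_
           (∑-supersets-sgn (omitted ∪ F))
           (trans (∑-*ˡ -1ℤ ss _) (cong (-1ℤ *_) (∑-supersets-sgn F))))) ⟩
    sgn ∣ F ∣ * (⟦ ⊤ ⊆? omitted ∪ F ⟧ * sgn (suc k) + -1ℤ * (⟦ ⊤ ⊆? F ⟧ * sgn (suc k)))
      ≡⟨ cong₂ (λ x y → sgn ∣ F ∣ * (x * sgn (suc k) + -1ℤ * (y * sgn (suc k))))
           (⟦⟧-⇔ (⊤ ⊆? omitted ∪ F) (∁ omitted ⊆? F) cover⇒ cover⇐)
           (⟦⟧-false (⊤ ⊆? F) (λ ⊤⊆F → face⇒⊉ F∈Δ (⊆-trans ⊆⊤ ⊤⊆F))) ⟩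
    sgn ∣ F ∣ * (⟦ ∁ omitted ⊆? F ⟧ * sgn (suc k) + -1ℤ * (0ℤ * sgn (suc k)))
      ≡⟨ tidy (sgn ∣ F ∣) ⟦ ∁ omitted ⊆? F ⟧ (sgn (suc k)) ⟩
    sgn ∣ F ∣ * (sgn (suc k) * ⟦ ∁ omitted ⊆? F ⟧) ∎
    where
    ss = subsets (suc k)
    tidy : ∀ x y z → x * (y * z + -1ℤ * (0ℤ * z)) ≡ x * (z * y)
    tidy = solve-∀
    cover⇒ : ⊤ ⊆ omitted ∪ F → ∁ omitted ⊆ F
    cover⇒ ⊤⊆ x∈∁omitted = [ (λ x∈omitted → contradiction x∈omitted (x∈∁p⇒x∉p x∈∁omitted)) , (λ x∈F → x∈F) ]′
      (x∈p∪q⁻ omitted F (⊤⊆ ∈⊤))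
    cover⇐ : ∁ omitted ⊆ F → ⊤ ⊆ omitted ∪ F
    cover⇐ ∁omitted⊆F {x} _ with x ∈? omitted
    ... | yes x∈omitted = x∈p∪q⁺ (inj₁ x∈omitted)
    ... | no  x∉omitted = x∈p∪q⁺ (inj₂ (∁omitted⊆F (x∉p⇒x∈∁p x∉omitted)))
    expand : ∀ x y f h → (1ℤ - x) * (y * - (f * h)) ≡ f * (x * y * h + -1ℤ * (y * h))
    expand = solve-∀
    summand : ∀ H → ⟦ isFace? H ×-dec (F ⊆? H) ⟧ * -1^ (dim H - dim F - 1ℤ) ≡
      sgn ∣ F ∣ * (⟦ omitted ∪ F ⊆? H ⟧ * sgn ∣ H ∣ + -1ℤ * (⟦ F ⊆? H ⟧ * sgn ∣ H ∣))
    summand H = begin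
      ⟦ isFace? H ×-dec (F ⊆? H) ⟧ * e
        ≡⟨ cong (_* e) (⟦⟧-× (isFace? H) (F ⊆? H)) ⟩
      ⟦ isFace? H ⟧ * ⟦ F ⊆? H ⟧ * e
        ≡⟨ ℤ.*-assoc ⟦ isFace? H ⟧ ⟦ F ⊆? H ⟧ e ⟩
      ⟦ isFace? H ⟧ * (⟦ F ⊆? H ⟧ * e)
        ≡⟨ cong₂ _*_ (⟦isFace⟧ H) (⟦⟧*-cong (F ⊆? H) 1^-dim) ⟩
      (1ℤ - ⟦ omitted ⊆? H ⟧) * (⟦ F ⊆? H ⟧ * - (sgn ∣ F ∣ * sgn ∣ H ∣))
        ≡⟨ expand ⟦ omitted ⊆? H ⟧ ⟦ F ⊆? H ⟧ (sgn ∣ F ∣) (sgn ∣ H ∣) ⟩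
      sgn ∣ F ∣ * (⟦ omitted ⊆? H ⟧ * ⟦ F ⊆? H ⟧ * sgn ∣ H ∣ + -1ℤ * (⟦ F ⊆? H ⟧ * sgn ∣ H ∣))
        ≡⟨ cong (λ x → sgn ∣ F ∣ * (x * sgn ∣ H ∣ + -1ℤ * (⟦ F ⊆? H ⟧ * sgn ∣ H ∣)))
             (⟦∪⊆⟧ omitted F H) ⟩
      sgn ∣ F ∣ * (⟦ omitted ∪ F ⊆? H ⟧ * sgn ∣ H ∣ + -1ℤ * (⟦ F ⊆? H ⟧ * sgn ∣ H ∣)) ∎
      where e = -1^ (dim H - dim F - 1ℤ)

-- The ab-index of a semisuspension

∑-zero-All : ∀ {xs} {f : A → ℤ} → All (λ x → f x ≡ 0ℤ) xs → ∑ xs f ≡ 0ℤ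
∑-zero-All {f = f} []         = ∑-[] f
∑-zero-All {f = f} (fx≡0 ∷ f≡0) =
  trans (∑-∷ _ _ f) (cong₂ _+_ fx≡0 (∑-zero-All f≡0))

∑-support : ∀ {x : A} {xs} {f : A → ℤ} → Unique xs → x List.∈ xs →
            (∀ y → x ≢ y → f y ≡ 0ℤ) → ∑ xs f ≡ f x
∑-support {x = x} {f = f} (x∉xs ∷ _) (Any.here refl) f≡0 =
  trans (∑-∷ x _ f) (trans (cong (f x +_) (∑-zero-All (All.map (f≡0 _) x∉xs))) (ℤ.+-identityʳ (f x)))
∑-support {x = x} {xs = z ∷ _} {f = f} (z∉xs ∷ u) (Any.there x∈xs) f≡0 =
  trans (∑-∷ z _ f) (trans
    (cong₂ _+_ (f≡0 z λ { refl → All.lookup z∉xs x∈xs refl }) (∑-support u x∈xs f≡0))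
    (ℤ.+-identityˡ (f x)))

⊆∧≢⇒∣∣≢ : ∀ {m} {F H : Subset m} → F ⊆ H → F ≢ H → ∣ F ∣ ≢ ∣ H ∣
⊆∧≢⇒∣∣≢ F⊆H F≢H = ℕ.<⇒≢ (⊆∧≢⇒∣∣< F⊆H F≢H)

module _ (n : ℕ) where

  -- The only chain from `∗` to `top` is the single step. Its exponent equals 0 but keeps the form
  -- in which the chain weight produces it.
  apexSum : ℕ → Word → ℤ
  apexSum zero    w = 0ℤ
  apexSum (suc f) w = coeff (𝐮^ (suc n ∸ n ∸ 1)) w

  -- Continuation through `∗` with the factor ζ̄ left out, so that `kernel` can take it as a
  -- parameter. Faces of size n are incomparable to `∗`, whence the indicator.
  viaApex : ℕ → ℕ → Word → ℤ
  viaApex f x w = ⟦ x ℕ.<? n ⟧ * act (step (n ∸ x ∸ 1)) (apexSum f) w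

  -- kernel c f x y collects the chains with at most f steps starting at a face
  -- of size x whose last face H has size y and satisfies ζ̄(H,∗) = c; kernel₁ is
  -- its slope in c.
  kernel : ℤ → ℕ → ℕ → ℕ → Word → ℤ
  kernel c zero    x y w = 0ℤ
  kernel c (suc f) x y w =
    ⟦ x ℕ.≟ y ⟧ * (c * viaApex f x w + coeff (𝐮^ (suc n ∸ x ∸ 1)) w) +
    binomSum (y ∸ x) x (λ z → ⟦ x ℕ.<? z ⟧ * act (step (z ∸ x ∸ 1)) (kernel c f z y) w)

  kernel₁ : ℕ → ℕ → ℕ → Word → ℤ
  kernel₁ zero    x y w = 0ℤ
  kernel₁ (suc f) x y w =
    ⟦ x ℕ.≟ y ⟧ * viaApex f x w +
    binomSum (y ∸ x) x (λ z → ⟦ x ℕ.<? z ⟧ * act (step (z ∸ x ∸ 1)) (kernel₁ f z y) w)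

  -- A chain enters `∗` at most once, and only from its last face, so `c` occurs at most to the
  -- first power in each weight.
  kernel-affine : ∀ c f x y w →
                  kernel c f x y w ≡ c * kernel₁ f x y w + kernel 0ℤ f x y w
  kernel-affine c zero    x y w = sym (trans (ℤ.+-identityʳ (c * 0ℤ)) (ℤ.*-zeroʳ c))
  kernel-affine c (suc f) x y w = begin
    e * (c * v + t) + binomSum (y ∸ x) x (branch (kernel c f))
      ≡⟨ cong (e * (c * v + t) +_) (binomSum-linear (y ∸ x) x c branch-affine) ⟩
    e * (c * v + t) +
    (c * binomSum (y ∸ x) x (branch (kernel₁ f)) + binomSum (y ∸ x) x (branch (kernel 0ℤ f)))
      ≡⟨ collect e c v t (binomSum (y ∸ x) x (branch (kernel₁ f)))
           (binomSum (y ∸ x) x (branch (kernel 0ℤ f))) ⟩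
    c * kernel₁ (suc f) x y w + kernel 0ℤ (suc f) x y w ∎
    where
    e = ⟦ x ℕ.≟ y ⟧
    v = viaApex f x w
    t = coeff (𝐮^ (suc n ∸ x ∸ 1)) w
    branch : (ℕ → ℕ → Word → ℤ) → ℕ → ℤ
    branch g z = ⟦ x ℕ.<? z ⟧ * act (step (z ∸ x ∸ 1)) (g z y) w
    distrib : ∀ i c p q → i * (c * p + q) ≡ c * (i * p) + i * q
    distrib = solve-∀
    collect : ∀ e c v t p q →
      e * (c * v + t) + (c * p + q) ≡ c * (e * v + p) + (e * (0ℤ * v + t) + q)
    collect = solve-∀
    branch-affine : ∀ z → branch (kernel c f) z ≡ c * branch (kernel₁ f) z + branch (kernel 0ℤ f) z
    branch-affine z = begin
      ⟦ x ℕ.<? z ⟧ * act s (kernel c f z y) w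
        ≡⟨ cong (⟦ x ℕ.<? z ⟧ *_) (act-cong s (kernel-affine c f z y) w) ⟩
      ⟦ x ℕ.<? z ⟧ * act s (λ u → c * kernel₁ f z y u + kernel 0ℤ f z y u) w
        ≡⟨ cong (⟦ x ℕ.<? z ⟧ *_) (act-linear s c (kernel₁ f z y) (kernel 0ℤ f z y) w) ⟩
      ⟦ x ℕ.<? z ⟧ * (c * act s (kernel₁ f z y) w + act s (kernel 0ℤ f z y) w)
        ≡⟨ distrib ⟦ x ℕ.<? z ⟧ c (act s (kernel₁ f z y) w) (act s (kernel 0ℤ f z y) w) ⟩
      c * branch (kernel₁ f) z + branch (kernel 0ℤ f) z ∎
      where s = step (z ∸ x ∸ 1)

module _ {m} (Δ : SimplicialComplex m) (n : ℕ) (1≤n : 1 ≤ n)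
         (dim<n : ∀ F → SimplicialComplex.IsFace Δ F → ∣ F ∣ ≤ n) where
  open SimplicialComplex Δ
  open Semi Δ n 1≤n dim<n
  open BoundedQuasiGradedPoset facePoset using (quasiGradedPoset; _≺_; _≺?_)

  private
    Q = quasiGradedPoset
    ss = subsets m

  ζ∗ : Subset m → ℤ
  ζ∗ F = 1ℤ + sgn (n ∸ ∣ F ∣) * χ̃-link Δ F

  ∑-faces : ∀ Fs (g : Element → ℤ) (h : Subset m → ℤ) →
    (∀ F (p : IsFace F) → g (face F p) ≡ h F) →
    ∑ (faces Fs) g ≡ ∑ Fs (λ F → ⟦ isFace? F ⟧ * h F)
  ∑-faces []       g h g≡h = trans (∑-[] g) (sym (∑-[] _))
  ∑-faces (F ∷ Fs) g h g≡h = trans faces-∷ (sym (∑-∷ F Fs (λ F → ⟦ isFace? F ⟧ * h F)))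
    where
    s = ∑ Fs (λ F → ⟦ isFace? F ⟧ * h F)
    faces-∷ : ∑ (faces (F ∷ Fs)) g ≡ ⟦ isFace? F ⟧ * h F + s
    faces-∷ with isFace? F
    ... | yes p = begin
      ∑ (face F p ∷ faces Fs) g       ≡⟨ ∑-∷ (face F p) (faces Fs) g ⟩
      g (face F p) + ∑ (faces Fs) g   ≡⟨ cong₂ _+_ (g≡h F p) (∑-faces Fs g h g≡h) ⟩
      h F + s                         ≡⟨ cong (_+ s) (ℤ.*-identityˡ (h F)) ⟨
      1ℤ * h F + s                    ≡⟨ cong (λ e → e * h F + s) (⟦⟧-true (yes p) p) ⟨
      ⟦ yes p ⟧ * h F + s             ∎
    ... | no ¬p = begin
      ∑ (faces Fs) g                  ≡⟨ ∑-faces Fs g h g≡h ⟩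
      s                               ≡⟨ ℤ.+-identityˡ s ⟨
      0ℤ * h F + s                    ≡⟨ cong (λ e → e * h F + s) (⟦⟧-false (no ¬p) ¬p) ⟨
      ⟦ no ¬p ⟧ * h F + s             ∎

  top⊀ : ∀ y → ¬ top ≺ y
  top⊀ top (_ , t≢t) = t≢t refl

  next-top : ∀ f w y → next Q f top top w y ≡ 0ℤ
  next-top f w y = cong (_* (1ℤ * act (step (rank y ∸ suc n ∸ 1)) (Ψ[ Q ] f y top) w))
                        (⟦⟧-false (top ≺? y) (top⊀ y))

  Ψ-top : ∀ f w → Ψ[ Q ] f top top w ≡ 0ℤ
  Ψ-top zero    w = refl
  Ψ-top (suc f) w = begin
    Ψ[ Q ] (suc f) top top w
      ≡⟨ Ψ-suc Q f top top w ⟩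
    ⟦ top ≺? top ⟧ * (1ℤ * coeff (𝐮^ (suc n ∸ suc n ∸ 1)) w) + ∑ _ (next Q f top top w)
      ≡⟨ cong₂ (λ e s → e * (1ℤ * coeff (𝐮^ (suc n ∸ suc n ∸ 1)) w) + s)
           (⟦⟧-false (top ≺? top) (top⊀ top)) (∑-zero _ (next-top f w)) ⟩
    0ℤ ∎

  -- The recursion also tries `top` as an intermediate element; no chain continues from there.
  next-to-top : ∀ f x w → next Q f x top w top ≡ 0ℤ
  next-to-top f x w = begin
    ⟦ x ≺? top ⟧ * (zeta x top * act s (Ψ[ Q ] f top top) w)
      ≡⟨ cong (λ t → ⟦ x ≺? top ⟧ * (zeta x top * t))
           (trans (act-cong s (Ψ-top f) w) (act-zero s w)) ⟩
    ⟦ x ≺? top ⟧ * (zeta x top * 0ℤ)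
      ≡⟨ vanish ⟦ x ≺? top ⟧ (zeta x top) ⟩
    0ℤ ∎
    where
    s = step (suc n ∸ rank x ∸ 1)
    vanish : ∀ p q → p * (q * 0ℤ) ≡ 0ℤ
    vanish = solve-∀

  next-∗ : ∀ f w y → next Q f ∗ top w y ≡ 0ℤ
  next-∗ f w (face F p) = cong (_* (1ℤ * act (step (∣ F ∣ ∸ n ∸ 1)) (Ψ[ Q ] f (face F p) top) w))
                               (⟦⟧-false (∗ ≺? face F p) λ { (() , _) })
  next-∗ f w ∗          = cong (_* (1ℤ * act (step (n ∸ n ∸ 1)) (Ψ[ Q ] f ∗ top) w))
                               (⟦⟧-false (∗ ≺? ∗) λ (_ , ∗≢∗) → ∗≢∗ refl)
  next-∗ f w top        = next-to-top f ∗ w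

  ≺top : ∀ {x} → x ≢ top → x ≺ top
  ≺top x≢top = ⊑top , x≢top

  Ψ-direct : ∀ x → x ≢ top → ∀ t → ⟦ x ≺? top ⟧ * (1ℤ * t) ≡ t
  Ψ-direct x x≢top t = begin
    ⟦ x ≺? top ⟧ * (1ℤ * t)  ≡⟨ cong (_* (1ℤ * t)) (⟦⟧-true (x ≺? top) (≺top x≢top)) ⟩
    1ℤ * (1ℤ * t)            ≡⟨ units t ⟩
    t                        ∎
    where
    units : ∀ p → 1ℤ * (1ℤ * p) ≡ p
    units = solve-∀

  Ψ-∗ : ∀ f w → Ψ[ Q ] f ∗ top w ≡ apexSum n f w
  Ψ-∗ zero    w = refl
  Ψ-∗ (suc f) w = begin
    Ψ[ Q ] (suc f) ∗ top w
      ≡⟨ Ψ-suc Q f ∗ top w ⟩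
    ⟦ ∗ ≺? top ⟧ * (1ℤ * t) + ∑ _ (next Q f ∗ top w)
      ≡⟨ cong₂ _+_ (Ψ-direct ∗ (λ ()) t) (∑-zero _ (next-∗ f w)) ⟩
    t + 0ℤ
      ≡⟨ ℤ.+-identityʳ t ⟩
    t ∎
    where t = coeff (𝐮^ (suc n ∸ n ∸ 1)) w

  faceSum : ℕ → Subset m → Word → ℤ
  faceSum f F w =
    ∑ ss (λ H → ⟦ isFace? H ⟧ * ⟦ F ⊆? H ⟧ * kernel n (ζ∗ H) f (∣ F ∣) (∣ H ∣) w)

  -- Nested sets of equal size are equal, so the size test in `kernel` detects `H = F` although
  -- `kernel` sees only sizes.
  ∑-diagonal : ∀ {F} → IsFace F → (g : Subset m → ℤ) →
    ∑ ss (λ H → ⟦ isFace? H ⟧ * ⟦ F ⊆? H ⟧ * (⟦ ∣ F ∣ ℕ.≟ ∣ H ∣ ⟧ * g H)) ≡ g F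
  ∑-diagonal {F} F∈Δ g = trans
    (∑-support (subsets-unique m) (subsets-complete F) off)
    (trans (cong₂ (λ x y → x * (y * g F))
      (cong₂ _*_ (⟦⟧-true (isFace? F) F∈Δ) (⟦⟧-true (F ⊆? F) ⊆-refl))
      (⟦⟧-true (∣ F ∣ ℕ.≟ ∣ F ∣) refl))
      (units (g F)))
    where
    units : ∀ p → 1ℤ * 1ℤ * (1ℤ * p) ≡ p
    units = solve-∀
    absorb : ∀ p q → p * (q * 0ℤ) ≡ 0ℤ
    absorb = solve-∀
    off : ∀ H → F ≢ H → ⟦ isFace? H ⟧ * ⟦ F ⊆? H ⟧ * (⟦ ∣ F ∣ ℕ.≟ ∣ H ∣ ⟧ * g H) ≡ 0ℤ
    off H F≢H = begin
      ⟦ isFace? H ⟧ * ⟦ F ⊆? H ⟧ * (⟦ ∣ F ∣ ℕ.≟ ∣ H ∣ ⟧ * g H)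
        ≡⟨ ℤ.*-assoc ⟦ isFace? H ⟧ ⟦ F ⊆? H ⟧ _ ⟩
      ⟦ isFace? H ⟧ * (⟦ F ⊆? H ⟧ * (⟦ ∣ F ∣ ℕ.≟ ∣ H ∣ ⟧ * g H))
        ≡⟨ cong (⟦ isFace? H ⟧ *_) (⟦⟧*-cong (F ⊆? H) λ F⊆H →
             cong (_* g H) (⟦⟧-false (∣ F ∣ ℕ.≟ ∣ H ∣) (⊆∧≢⇒∣∣≢ F⊆H F≢H))) ⟩
      ⟦ isFace? H ⟧ * (⟦ F ⊆? H ⟧ * 0ℤ)
        ≡⟨ absorb ⟦ isFace? H ⟧ ⟦ F ⊆? H ⟧ ⟩
      0ℤ ∎

  branch : ℕ → Subset m → Subset m → Word → ℕ → ℤ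
  branch f F H w z =
    ⟦ ∣ F ∣ ℕ.<? z ⟧ * act (step (z ∸ ∣ F ∣ ∸ 1)) (kernel n (ζ∗ H) f z ∣ H ∣) w

  -- Here `G` is the next face and `H` the last one. With `H` fixed first, down-closure makes every
  -- `G` between `F` and `H` a face, and the summand depends on `G` only through its size;
  -- `∑-interval` then evaluates the inner sum.
  ∑-branch : ∀ f F w →
    ∑ ss (λ G → ⟦ isFace? G ⟧ * (⟦ F ⊆? G ⟧ * (⟦ ∣ F ∣ ℕ.<? ∣ G ∣ ⟧ *
      act (step (∣ G ∣ ∸ ∣ F ∣ ∸ 1)) (faceSum f G) w))) ≡
    ∑ ss (λ H → ⟦ isFace? H ⟧ * ⟦ F ⊆? H ⟧ * binomSum (∣ H ∣ ∸ ∣ F ∣) (∣ F ∣) (branch f F H w))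
  ∑-branch f F w = begin
    ∑ ss (λ G → ⟦ isFace? G ⟧ * (⟦ F ⊆? G ⟧ * (⟦ ∣ F ∣ ℕ.<? ∣ G ∣ ⟧ *
      act (step (∣ G ∣ ∸ ∣ F ∣ ∸ 1)) (faceSum f G) w)))
      ≡⟨ ∑-cong ss expand ⟩
    ∑ ss (λ G → ∑ ss (summand G))
      ≡⟨ ∑-swap ss ss summand ⟩
    ∑ ss (λ H → ∑ ss (λ G → summand G H))
      ≡⟨ ∑-cong ss contract ⟩
    ∑ ss (λ H → ⟦ isFace? H ⟧ * ⟦ F ⊆? H ⟧ * binomSum (∣ H ∣ ∸ ∣ F ∣) (∣ F ∣) (branch f F H w)) ∎
    where
    summand : Subset m → Subset m → ℤ
    summand G H = ⟦ isFace? H ⟧ * (⟦ F ⊆? G ⟧ * (⟦ G ⊆? H ⟧ * branch f F H w ∣ G ∣))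
    contract : ∀ H → ∑ ss (λ G → summand G H) ≡
      ⟦ isFace? H ⟧ * ⟦ F ⊆? H ⟧ * binomSum (∣ H ∣ ∸ ∣ F ∣) (∣ F ∣) (branch f F H w)
    contract H = begin
      ∑ ss (λ G → summand G H)
        ≡⟨ ∑-*ˡ ⟦ isFace? H ⟧ ss _ ⟩
      ⟦ isFace? H ⟧ * ∑ ss (λ G → ⟦ F ⊆? G ⟧ * (⟦ G ⊆? H ⟧ * branch f F H w ∣ G ∣))
        ≡⟨ cong (⟦ isFace? H ⟧ *_) (∑-interval F H (branch f F H w)) ⟩
      ⟦ isFace? H ⟧ * (⟦ F ⊆? H ⟧ * binomSum (∣ H ∣ ∸ ∣ F ∣) (∣ F ∣) (branch f F H w))
        ≡⟨ ℤ.*-assoc ⟦ isFace? H ⟧ ⟦ F ⊆? H ⟧ _ ⟨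
      ⟦ isFace? H ⟧ * ⟦ F ⊆? H ⟧ * binomSum (∣ H ∣ ∸ ∣ F ∣) (∣ F ∣) (branch f F H w) ∎
    gather : ∀ p q r s x y → p * (q * r) * (s * x * y) ≡ q * (s * (x * (p * (r * y))))
    gather = solve-∀
    regroup : ∀ q s x y → q * (s * (x * y)) ≡ s * (q * (x * y))
    regroup = solve-∀
    face-absorb : ∀ G H y → ⟦ isFace? H ⟧ * (⟦ G ⊆? H ⟧ * (⟦ isFace? G ⟧ * y)) ≡
                            ⟦ isFace? H ⟧ * (⟦ G ⊆? H ⟧ * y)
    face-absorb G H y = ⟦⟧*-cong (isFace? H) λ H∈Δ → ⟦⟧*-cong (G ⊆? H) λ G⊆H →
      trans (cong (_* y) (⟦⟧-true (isFace? G) (down-closed G⊆H H∈Δ))) (ℤ.*-identityˡ y)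
    expand : ∀ G → ⟦ isFace? G ⟧ * (⟦ F ⊆? G ⟧ * (⟦ ∣ F ∣ ℕ.<? ∣ G ∣ ⟧ *
      act (step (∣ G ∣ ∸ ∣ F ∣ ∸ 1)) (faceSum f G) w)) ≡ ∑ ss (summand G)
    expand G = begin
      γ * (φ * (l * act s (faceSum f G) w))
        ≡⟨ assoc γ φ l (act s (faceSum f G) w) ⟩
      γ * (φ * l) * act s (faceSum f G) w
        ≡⟨ cong (γ * (φ * l) *_) (act-∑ s ss (λ H → ⟦ isFace? H ⟧ * ⟦ G ⊆? H ⟧)
             (λ H → kernel n (ζ∗ H) f (∣ G ∣) (∣ H ∣)) w) ⟩
      γ * (φ * l) * ∑ ss (λ H → ⟦ isFace? H ⟧ * ⟦ G ⊆? H ⟧ * κ H)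
        ≡⟨ ∑-*ˡ (γ * (φ * l)) ss _ ⟨
      ∑ ss (λ H → γ * (φ * l) * (⟦ isFace? H ⟧ * ⟦ G ⊆? H ⟧ * κ H))
        ≡⟨ ∑-cong ss (λ H → begin
             γ * (φ * l) * (⟦ isFace? H ⟧ * ⟦ G ⊆? H ⟧ * κ H)
               ≡⟨ gather γ φ l ⟦ isFace? H ⟧ ⟦ G ⊆? H ⟧ (κ H) ⟩
             φ * (⟦ isFace? H ⟧ * (⟦ G ⊆? H ⟧ * (γ * (l * κ H))))
               ≡⟨ cong (φ *_) (face-absorb G H (l * κ H)) ⟩
             φ * (⟦ isFace? H ⟧ * (⟦ G ⊆? H ⟧ * (l * κ H)))
               ≡⟨ regroup φ ⟦ isFace? H ⟧ ⟦ G ⊆? H ⟧ (l * κ H) ⟩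
             summand G H ∎) ⟩
      ∑ ss (summand G) ∎
      where
      γ = ⟦ isFace? G ⟧
      φ = ⟦ F ⊆? G ⟧
      l = ⟦ ∣ F ∣ ℕ.<? ∣ G ∣ ⟧
      s = step (∣ G ∣ ∸ ∣ F ∣ ∸ 1)
      κ = λ H → act s (kernel n (ζ∗ H) f (∣ G ∣) (∣ H ∣)) w
      assoc : ∀ p q r x → p * (q * (r * x)) ≡ p * (q * r) * x
      assoc = solve-∀

  -- Strictness is expressed through sizes, so that it can be absorbed into the function of ∣G∣ that
  -- `∑-interval` takes.
  ⟦face≺face⟧ : ∀ {F G} .(p : IsFace F) .(q : IsFace G) →
    ⟦ face F p ≺? face G q ⟧ ≡ ⟦ F ⊆? G ⟧ * ⟦ ∣ F ∣ ℕ.<? ∣ G ∣ ⟧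
  ⟦face≺face⟧ {F} {G} p q = trans
    (⟦⟧-⇔ (face F p ≺? face G q) (F ⊆? G ×-dec ∣ F ∣ ℕ.<? ∣ G ∣)
      (λ { (face⊑face F⊆G , F≢G) → F⊆G , rank-mono (face⊑face {p = p} {q = q} F⊆G , F≢G) })
      (λ (F⊆G , F<G) → face⊑face F⊆G , λ { refl → ℕ.<-irrefl refl F<G }))
    (⟦⟧-× (F ⊆? G) (∣ F ∣ ℕ.<? ∣ G ∣))

  ⟦face≺∗⟧ : ∀ {F} .(p : IsFace F) → ⟦ face F p ≺? ∗ ⟧ ≡ ⟦ ∣ F ∣ ℕ.<? n ⟧
  ⟦face≺∗⟧ {F} p = ⟦⟧-⇔ (face F p ≺? ∗) (∣ F ∣ ℕ.<? n)
    (λ { (face⊑∗ F<n , _) → F<n }) (λ F<n → face⊑∗ F<n , λ ())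

  -- Induction on the step bound. A first step to `top` or `∗` makes `F` itself the last face; a
  -- first step to a larger face falls under the induction hypothesis.
  Ψ-face : ∀ f F .(p : IsFace F) w → Ψ[ Q ] f (face F p) top w ≡ faceSum f F w
  Ψ-face zero    F p w = sym (∑-zero ss λ H → ℤ.*-zeroʳ (⟦ isFace? H ⟧ * ⟦ F ⊆? H ⟧))
  Ψ-face (suc f) F p w = begin
    Ψ[ Q ] (suc f) (face F p) top w
      ≡⟨ Ψ-suc Q f (face F p) top w ⟩
    ⟦ face F p ≺? top ⟧ * (1ℤ * t) + ∑ (∗ ∷ top ∷ faces ss) nx
      ≡⟨ cong₂ _+_ (Ψ-direct (face F p) (λ ()) t)
           (trans (∑-∷ ∗ (top ∷ faces ss) nx) (cong (nx ∗ +_) (∑-∷ top (faces ss) nx))) ⟩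
    t + (nx ∗ + (nx top + ∑ (faces ss) nx))
      ≡⟨ cong (t +_) (cong₂ _+_ nx-∗ (cong₂ _+_ (next-to-top f (face F p) w) nx-faces)) ⟩
    t + (ζ∗ F * viaApex n f (∣ F ∣) w + (0ℤ + ∑ ss below))
      ≡⟨ rearrange t (ζ∗ F * viaApex n f (∣ F ∣) w) (∑ ss below) ⟩
    source F + ∑ ss below
      -- The proof `p` is irrelevant; deciding `IsFace F` recovers a usable one.
      ≡⟨ cong₂ _+_ (sym (∑-diagonal (recompute (isFace? F) p) source)) (∑-branch f F w) ⟩
    ∑ ss (λ H → ⟦ isFace? H ⟧ * ⟦ F ⊆? H ⟧ * (⟦ ∣ F ∣ ℕ.≟ ∣ H ∣ ⟧ * source H)) +
    ∑ ss (λ H → ⟦ isFace? H ⟧ * ⟦ F ⊆? H ⟧ * bs H)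
      ≡⟨ ∑-+ ss _ _ ⟨
    ∑ ss (λ H → ⟦ isFace? H ⟧ * ⟦ F ⊆? H ⟧ * (⟦ ∣ F ∣ ℕ.≟ ∣ H ∣ ⟧ * source H) +
                ⟦ isFace? H ⟧ * ⟦ F ⊆? H ⟧ * bs H)
      ≡⟨ ∑-cong ss (λ H → ℤ.*-distribˡ-+ (⟦ isFace? H ⟧ * ⟦ F ⊆? H ⟧)
           (⟦ ∣ F ∣ ℕ.≟ ∣ H ∣ ⟧ * source H) (bs H)) ⟨
    faceSum (suc f) F w ∎
    where
    t = coeff (𝐮^ (suc n ∸ ∣ F ∣ ∸ 1)) w
    nx = next Q f (face F p) top w
    source : Subset m → ℤ
    source H = ζ∗ H * viaApex n f (∣ F ∣) w + t
    bs : Subset m → ℤ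
    bs H = binomSum (∣ H ∣ ∸ ∣ F ∣) (∣ F ∣) (branch f F H w)
    lower : Subset m → ℤ
    lower G = ⟦ F ⊆? G ⟧ * (⟦ ∣ F ∣ ℕ.<? ∣ G ∣ ⟧ *
      act (step (∣ G ∣ ∸ ∣ F ∣ ∸ 1)) (faceSum f G) w)
    below : Subset m → ℤ
    below G = ⟦ isFace? G ⟧ * lower G
    rearrange : ∀ t x y → t + (x + (0ℤ + y)) ≡ (x + t) + y
    rearrange = solve-∀
    commute : ∀ l z x → l * (z * x) ≡ z * (l * x)
    commute = solve-∀
    drop-unit : ∀ x y z → x * y * (1ℤ * z) ≡ x * (y * z)
    drop-unit = solve-∀
    nx-∗ : nx ∗ ≡ ζ∗ F * viaApex n f (∣ F ∣) w
    nx-∗ = begin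
      ⟦ face F p ≺? ∗ ⟧ * (ζ∗ F * act s (Ψ[ Q ] f ∗ top) w)
        ≡⟨ cong₂ (λ x y → x * (ζ∗ F * y)) (⟦face≺∗⟧ p) (act-cong s (Ψ-∗ f) w) ⟩
      ⟦ ∣ F ∣ ℕ.<? n ⟧ * (ζ∗ F * act s (apexSum n f) w)
        ≡⟨ commute ⟦ ∣ F ∣ ℕ.<? n ⟧ (ζ∗ F) (act s (apexSum n f) w) ⟩
      ζ∗ F * viaApex n f (∣ F ∣) w ∎
      where s = step (n ∸ ∣ F ∣ ∸ 1)
    nx-faces : ∑ (faces ss) nx ≡ ∑ ss below
    nx-faces = ∑-faces ss nx lower λ G q → let s = step (∣ G ∣ ∸ ∣ F ∣ ∸ 1) in begin
      ⟦ face F p ≺? face G q ⟧ * (1ℤ * act s (Ψ[ Q ] f (face G q) top) w)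
        ≡⟨ cong₂ (λ x y → x * (1ℤ * y)) (⟦face≺face⟧ p q) (act-cong s (Ψ-face f G q) w) ⟩
      ⟦ F ⊆? G ⟧ * ⟦ ∣ F ∣ ℕ.<? ∣ G ∣ ⟧ * (1ℤ * act s (faceSum f G) w)
        ≡⟨ drop-unit ⟦ F ⊆? G ⟧ ⟦ ∣ F ∣ ℕ.<? ∣ G ∣ ⟧ (act s (faceSum f G) w) ⟩
      lower G ∎

  coeff-Ψ : ∀ w → coeff (Ψ facePoset) w ≡
    ∑ ss (λ H → ⟦ isFace? H ⟧ *
      (ζ∗ H * kernel₁ n (suc n) 0 (∣ H ∣) w + kernel n 0ℤ (suc n) 0 (∣ H ∣) w))
  coeff-Ψ w = begin
    coeff (Ψ facePoset) w
      ≡⟨ Ψ-face (suc n ∸ ∣ ⊥ {m} ∣) ⊥ ∅-face w ⟩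
    ∑ ss (λ H → ⟦ isFace? H ⟧ * ⟦ ⊥ ⊆? H ⟧ * kernel n (ζ∗ H) (suc n ∸ ∣ ⊥ {m} ∣) (∣ ⊥ {m} ∣) (∣ H ∣) w)
      -- `∣ ⊥ ∣` does not reduce for a variable `m`. After this step the kernels no longer mention
      -- `m`, which allows complexes on different vertex sets to be compared.
      ≡⟨ ∑-cong ss (λ H → cong₂ (λ x y → ⟦ isFace? H ⟧ * x * kernel n (ζ∗ H) (suc n ∸ y) y (∣ H ∣) w)
           (⟦⟧-true (⊥ ⊆? H) ⊥⊆) (∣⊥∣≡0 m)) ⟩
    ∑ ss (λ H → ⟦ isFace? H ⟧ * 1ℤ * kernel n (ζ∗ H) (suc n) 0 (∣ H ∣) w)
      ≡⟨ ∑-cong ss (λ H → cong₂ _*_ (ℤ.*-identityʳ ⟦ isFace? H ⟧)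
           (kernel-affine n (ζ∗ H) (suc n) 0 (∣ H ∣) w)) ⟩
    ∑ ss (λ H → ⟦ isFace? H ⟧ *
      (ζ∗ H * kernel₁ n (suc n) 0 (∣ H ∣) w + kernel n 0ℤ (suc n) 0 (∣ H ∣) w)) ∎

-- Simplicial shelling components

module _ (n : ℕ) (w : Word) where

  -- For a last face of size `x`, `β` is the slope in ζ̄(H,∗) and `γ` the value at ζ̄(H,∗) = 1.
  β γ : ℕ → ℤ
  β x = kernel₁ n (suc n) 0 x w
  γ x = β x + kernel n 0ℤ (suc n) 0 x w

  -- The coefficient of w in the ab-index for the complex generated by j facets
  -- of the k-simplex; it vanishes for j = 0, where there are no faces.
  facetSum : ℕ → ℕ → ℤ
  facetSum k j =
    binomSum (suc k) 0 γ - binomSum (suc k ∸ j) j γ +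
    sgn n * sgn (suc k) * (binomSum j (suc k ∸ j) β - β (suc k))

  -- This lets the component with i = 0 be written as a difference like all the others.
  facetSum-0 : ∀ k → facetSum k 0 ≡ 0ℤ
  facetSum-0 k = cancel (binomSum (suc k) 0 γ) (sgn n * sgn (suc k)) (β (suc k))
    where
    cancel : ∀ x y z → x - x + y * (z - z) ≡ 0ℤ
    cancel = solve-∀

  -- Every face contributes `γ`: all subsets except the supersets of `Y`. Faces containing `∁ Y`
  -- contribute `β` times the sign in addition: all supersets of `∁ Y` except those that also
  -- contain `Y`, which is the full vertex set alone and accounts for `β (suc k)`.
  coeff-ΨP : ∀ k i 1≤n (i≤k : i ≤ k) (k≤n : k ≤ n) →
             coeff (Ψ (P n k i 1≤n i≤k k≤n)) w ≡ facetSum k (suc i)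
  coeff-ΨP k i 1≤n i≤k k≤n = begin
    coeff (Ψ (P n k i 1≤n i≤k k≤n)) w
      ≡⟨ coeff-Ψ Δ n 1≤n (Δ-dim k i k≤n) w ⟩
    ∑ ss (λ H → ⟦ isFace? H ⟧ * (ζ∗ Δ n 1≤n (Δ-dim k i k≤n) H * β ∣ H ∣ + α ∣ H ∣))
      -- The constant 1 is written as the indicator of `⊥ ⊆ H`, so that all four terms are sums over
      -- supersets.
      ≡⟨ ∑-cong ss summand ⟩
    ∑ ss (λ H → (⟦ ⊥ ⊆? H ⟧ * γ ∣ H ∣ + -1ℤ * (⟦ Y ⊆? H ⟧ * γ ∣ H ∣)) +
      σ * (⟦ ∁ Y ⊆? H ⟧ * β ∣ H ∣ + -1ℤ * (⟦ Y ∪ ∁ Y ⊆? H ⟧ * β ∣ H ∣)))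
      ≡⟨ trans (∑-+ ss _ _) (cong₂ _+_ (∑-difference ⊥ Y γ)
           (trans (∑-*ˡ σ ss _) (cong (σ *_) (∑-difference (∁ Y) (Y ∪ ∁ Y) β)))) ⟩
    (above ⊥ γ + -1ℤ * above Y γ) + σ * (above (∁ Y) β + -1ℤ * above (Y ∪ ∁ Y) β)
      ≡⟨ cong₂ (λ x y → x + σ * y)
           (cong₂ (λ x y → x + -1ℤ * y)
             (cong (λ e → binomSum (suc k ∸ e) e γ) (∣⊥∣≡0 (suc k)))
             (cong (λ e → binomSum (suc k ∸ e) e γ) ∣Y∣))
           (cong₂ (λ x y → x + -1ℤ * y)
             (trans (cong (λ e → binomSum (suc k ∸ e) e β) ∣∁Y∣)
                    (cong (λ e → binomSum e (suc k ∸ suc i) β) (ℕ.m∸[m∸n]≡n (s≤s i≤k))))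
             (trans (cong (λ e → binomSum (suc k ∸ e) e β) ∣Y∪∁Y∣)
                    (cong (λ e → binomSum e (suc k) β) (ℕ.n∸n≡0 (suc k))))) ⟩
    (binomSum (suc k) 0 γ + -1ℤ * binomSum (suc k ∸ suc i) (suc i) γ) +
    σ * (binomSum (suc i) (suc k ∸ suc i) β + -1ℤ * β (suc k))
      ≡⟨ subtract (binomSum (suc k) 0 γ) (binomSum (suc k ∸ suc i) (suc i) γ) σ
           (binomSum (suc i) (suc k ∸ suc i) β) (β (suc k)) ⟩
    facetSum k (suc i) ∎
    where
    Δ = Δ[ k , i ]
    open SimplicialComplex Δ using (isFace?)
    ss = subsets (suc k)
    Y = omitted k i
    σ = sgn n * sgn (suc k)
    α = λ x → kernel n 0ℤ (suc n) 0 x w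
    above : Subset (suc k) → (ℕ → ℤ) → ℤ
    above F h = binomSum (suc k ∸ ∣ F ∣) (∣ F ∣) h
    subtract : ∀ x y s z t → (x + -1ℤ * y) + s * (z + -1ℤ * t) ≡ x - y + s * (z - t)
    subtract = solve-∀
    ∣Y∣ : ∣ Y ∣ ≡ suc i
    ∣Y∣ = ∣initial∣ (s≤s i≤k)
    ∣∁Y∣ : ∣ ∁ Y ∣ ≡ suc k ∸ suc i
    ∣∁Y∣ = trans (∣∁p∣≡n∸∣p∣ Y) (cong (suc k ∸_) ∣Y∣)
    ∣Y∪∁Y∣ : ∣ Y ∪ ∁ Y ∣ ≡ suc k
    ∣Y∪∁Y∣ = trans (cong ∣_∣ (p∪∁p≡⊤ Y)) (∣⊤∣≡n (suc k))
    ∑-difference : ∀ F G h →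
      ∑ ss (λ H → ⟦ F ⊆? H ⟧ * h ∣ H ∣ + -1ℤ * (⟦ G ⊆? H ⟧ * h ∣ H ∣)) ≡ above F h + -1ℤ * above G h
    ∑-difference F G h = trans (∑-+ ss _ _) (cong₂ _+_ (∑-supersets F h)
      (trans (∑-*ˡ -1ℤ ss _) (cong (-1ℤ *_) (∑-supersets G h))))
    -- The sign of ∣H∣ occurs in the exponent n - ∣H∣ and again in the Euler characteristic. The two
    -- cancel, and the remaining sign `σ` is the same for all faces.
    ζ∗≡ : ∀ {H} → SimplicialComplex.IsFace Δ H →
          ζ∗ Δ n 1≤n (Δ-dim k i k≤n) H ≡ 1ℤ + σ * ⟦ ∁ Y ⊆? H ⟧
    ζ∗≡ {H} H∈Δ = cong (1ℤ +_) (begin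
      sgn (n ∸ ∣ H ∣) * χ̃-link Δ H
        ≡⟨ cong₂ _*_ (sgn-∸ (Δ-dim k i k≤n H H∈Δ)) (χ̃-link≡ k i H∈Δ) ⟩
      sgn n * sgn ∣ H ∣ * (sgn ∣ H ∣ * (sgn (suc k) * ⟦ ∁ Y ⊆? H ⟧))
        ≡⟨ regroup (sgn n) (sgn ∣ H ∣) (sgn (suc k)) ⟦ ∁ Y ⊆? H ⟧ ⟩
      sgn ∣ H ∣ * sgn ∣ H ∣ * (σ * ⟦ ∁ Y ⊆? H ⟧)
        ≡⟨ cong (_* (σ * ⟦ ∁ Y ⊆? H ⟧)) (sgn²≡1 ∣ H ∣) ⟩
      1ℤ * (σ * ⟦ ∁ Y ⊆? H ⟧)
        ≡⟨ ℤ.*-identityˡ (σ * ⟦ ∁ Y ⊆? H ⟧) ⟩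
      σ * ⟦ ∁ Y ⊆? H ⟧ ∎)
      where
      regroup : ∀ p q r s → p * q * (q * (r * s)) ≡ q * q * (p * r * s)
      regroup = solve-∀
    expand : ∀ x y s b c → (1ℤ - x) * ((1ℤ + s * y) * b + c) ≡
      (1ℤ * (b + c) + -1ℤ * (x * (b + c))) + s * (y * b + -1ℤ * (x * y * b))
    expand = solve-∀
    summand : ∀ H →
      ⟦ isFace? H ⟧ * (ζ∗ Δ n 1≤n (Δ-dim k i k≤n) H * β ∣ H ∣ + α ∣ H ∣) ≡
      (⟦ ⊥ ⊆? H ⟧ * γ ∣ H ∣ + -1ℤ * (⟦ Y ⊆? H ⟧ * γ ∣ H ∣)) +
      σ * (⟦ ∁ Y ⊆? H ⟧ * β ∣ H ∣ + -1ℤ * (⟦ Y ∪ ∁ Y ⊆? H ⟧ * β ∣ H ∣))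
    summand H = begin
      ⟦ isFace? H ⟧ * (ζ∗ Δ n 1≤n (Δ-dim k i k≤n) H * β ∣ H ∣ + α ∣ H ∣)
        ≡⟨ ⟦⟧*-cong (isFace? H) (λ H∈Δ → cong (λ z → z * β ∣ H ∣ + α ∣ H ∣) (ζ∗≡ H∈Δ)) ⟩
      ⟦ isFace? H ⟧ * ((1ℤ + σ * ⟦ ∁ Y ⊆? H ⟧) * β ∣ H ∣ + α ∣ H ∣)
        ≡⟨ cong (_* ((1ℤ + σ * ⟦ ∁ Y ⊆? H ⟧) * β ∣ H ∣ + α ∣ H ∣)) (⟦isFace⟧ k i H) ⟩
      (1ℤ - ⟦ Y ⊆? H ⟧) * ((1ℤ + σ * ⟦ ∁ Y ⊆? H ⟧) * β ∣ H ∣ + α ∣ H ∣)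
        ≡⟨ expand ⟦ Y ⊆? H ⟧ ⟦ ∁ Y ⊆? H ⟧ σ (β ∣ H ∣) (α ∣ H ∣) ⟩
      (1ℤ * γ ∣ H ∣ + -1ℤ * (⟦ Y ⊆? H ⟧ * γ ∣ H ∣)) +
      σ * (⟦ ∁ Y ⊆? H ⟧ * β ∣ H ∣ + -1ℤ * (⟦ Y ⊆? H ⟧ * ⟦ ∁ Y ⊆? H ⟧ * β ∣ H ∣))
        ≡⟨ cong₂ (λ x y → (x * γ ∣ H ∣ + -1ℤ * (⟦ Y ⊆? H ⟧ * γ ∣ H ∣)) +
                          σ * (⟦ ∁ Y ⊆? H ⟧ * β ∣ H ∣ + -1ℤ * (y * β ∣ H ∣)))
             (sym (⟦⟧-true (⊥ ⊆? H) ⊥⊆)) (⟦∪⊆⟧ Y (∁ Y) H) ⟩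
      (⟦ ⊥ ⊆? H ⟧ * γ ∣ H ∣ + -1ℤ * (⟦ Y ⊆? H ⟧ * γ ∣ H ∣)) +
      σ * (⟦ ∁ Y ⊆? H ⟧ * β ∣ H ∣ + -1ℤ * (⟦ Y ∪ ∁ Y ⊆? H ⟧ * β ∣ H ∣)) ∎

  coeff-Φ̌ : ∀ k i 1≤n (i≤k : i ≤ k) (k≤n : k ≤ n) →
            coeff (Φ̌ n k i 1≤n i≤k k≤n) w ≡ facetSum k (suc i) - facetSum k i
  coeff-Φ̌ k zero    1≤n i≤k k≤n = begin
    coeff (Ψ (P n k 0 1≤n i≤k k≤n)) w  ≡⟨ coeff-ΨP k 0 1≤n i≤k k≤n ⟩
    facetSum k 1                       ≡⟨ ℤ.+-identityʳ (facetSum k 1) ⟨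
    facetSum k 1 - 0ℤ                  ≡⟨ cong (λ x → facetSum k 1 - x) (facetSum-0 k) ⟨
    facetSum k 1 - facetSum k 0        ∎
  coeff-Φ̌ k (suc i) 1≤n i<k k≤n = begin
    coeff (Ψ P₂ -ᵖ Ψ P₁) w
      ≡⟨ coeff-+ᵖ (Ψ P₂) (-1ℤ ·ᵖ Ψ P₁) w ⟩
    coeff (Ψ P₂) w + coeff (-1ℤ ·ᵖ Ψ P₁) w
      ≡⟨ cong (coeff (Ψ P₂) w +_) (coeff-·ᵖ -1ℤ (Ψ P₁) w) ⟩
    coeff (Ψ P₂) w + -1ℤ * coeff (Ψ P₁) w
      ≡⟨ cong₂ (λ x y → x + -1ℤ * y)
           (coeff-ΨP k (suc i) 1≤n i<k k≤n) (coeff-ΨP k i 1≤n (<⇒≤ i<k) k≤n) ⟩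
    facetSum k (suc (suc i)) + -1ℤ * facetSum k (suc i)
      ≡⟨ cong (facetSum k (suc (suc i)) +_) (ℤ.-1*i≡-i (facetSum k (suc i))) ⟩
    facetSum k (suc (suc i)) - facetSum k (suc i) ∎
    where
    P₂ = P n k (suc i) 1≤n i<k k≤n
    P₁ = P n k i 1≤n (<⇒≤ i<k) k≤n

  -- The sums over all subsets and the single terms `β (suc k)`, `β (suc (suc k))` cancel within
  -- each difference. What remains is Pascal's rule for `γ` and for `β`, with `sgn (suc (suc k))`
  -- opposite to `sgn (suc k)`.
  facetSum-recurrence : ∀ {k i} → i ≤ k →
    facetSum (suc k) (suc i) - facetSum (suc k) i ≡
    facetSum k (suc i) - facetSum k i + (facetSum (suc k) (suc (suc i)) - facetSum (suc k) (suc i))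
  facetSum-recurrence {k} {i} i≤k
    -- With the differences exposed as successors of `k ∸ i`, `binomSum` unfolds by definition; each
    -- unfolding is one use of Pascal's rule, and a ring identity is left.
    rewrite ℕ.+-∸-assoc 1 i≤k | ℕ.+-∸-assoc 2 i≤k =
    identity (binomSum (suc (suc k)) 0 γ) (binomSum (suc k) 0 γ)
      (binomSum (suc d) i γ) (binomSum d (suc i) γ) (binomSum d (suc (suc i)) γ)
      (sgn n) (sgn (suc k)) (binomSum i d β) (binomSum i (suc d) β) (binomSum i (suc (suc d)) β)
      (β (suc k)) (β (suc (suc k)))
    where
    d = k ∸ i
    identity : ∀ a a′ g₁ g₂ g₃ s t b₁ b₂ b₃ e e′ →
      (a - (g₂ + g₃) + s * (-1ℤ * t) * (b₂ + b₃ - e′)) -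
      (a - (g₁ + (g₂ + g₃)) + s * (-1ℤ * t) * (b₃ - e′)) ≡
      (a′ - g₂ + s * t * (b₁ + b₂ - e)) - (a′ - g₁ + s * t * (b₂ - e)) +
      ((a - g₃ + s * (-1ℤ * t) * (b₁ + b₂ + (b₂ + b₃) - e′)) -
       (a - (g₂ + g₃) + s * (-1ℤ * t) * (b₂ + b₃ - e′)))
    identity = solve-∀

proposition14p4 : (n k i : ℕ) (i≤k : i ≤ k) (k<n : k < n) →
    Φ̌ n (suc k) i (m<n⇒0<n k<n) (m≤n⇒m≤1+n i≤k) k<n
    ≈ᵖ Φ̌ n k i (m<n⇒0<n k<n) i≤k (<⇒≤ k<n)
    +ᵖ Φ̌ n (suc k) (suc i) (m<n⇒0<n k<n) (s≤s i≤k) k<n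
proposition14p4 n k i i≤k k<n w = begin
  coeff (Φ̌ n (suc k) i 1≤n (m≤n⇒m≤1+n i≤k) k<n) w
    ≡⟨ coeff-Φ̌ n w (suc k) i 1≤n (m≤n⇒m≤1+n i≤k) k<n ⟩
  facetSum n w (suc k) (suc i) - facetSum n w (suc k) i
    ≡⟨ facetSum-recurrence n w i≤k ⟩
  facetSum n w k (suc i) - facetSum n w k i +
  (facetSum n w (suc k) (suc (suc i)) - facetSum n w (suc k) (suc i))
    ≡⟨ cong₂ _+_ (coeff-Φ̌ n w k i 1≤n i≤k (<⇒≤ k<n))
         (coeff-Φ̌ n w (suc k) (suc i) 1≤n (s≤s i≤k) k<n) ⟨
  coeff Φ₁ w + coeff Φ₂ w
    ≡⟨ coeff-+ᵖ Φ₁ Φ₂ w ⟨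
  coeff (Φ₁ +ᵖ Φ₂) w ∎
  where
  1≤n = m<n⇒0<n k<n
  Φ₁ = Φ̌ n k i 1≤n i≤k (<⇒≤ k<n)
  Φ₂ = Φ̌ n (suc k) (suc i) 1≤n (s≤s i≤k) k<n
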